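{- Let $P$ be a $d$-polytope and let $P(n)$, $P(n)^\sharp$ be the $V(P)$-polytope numbers and interior polytope numbers. Then $P(0)=P(0)^\sharp=|\emptyset|=0$, $P(1)=|\{\mathbf{0}\}|=1$, $P(1)^\sharp=|\{\mathbf 0\}|=1$ if $d=0$ and $P(1)^\sharp=|\emptyset|=0$ if $d\ge1$, and for every $n\ge2$ $$P(n)=\bigg|\bigg\{\sum_{i=1}^{n-1}\mathbf{v}_{F_i} : F_1\supseteq F_2\supseteq\cdots\supseteq F_{n-1}\bigg\}\bigg|,$$ $$P(n)^{\sharp}=\bigg|\bigg\{\sum_{i=1}^{n-1}\mathbf{v}_{F_i} : F_1\supseteq F_2\supseteq\cdots\supseteq F_{n-1},\ conv\big(\{\mathbf{v}_{F_1},\mathbf{v}_{F_2},\ldots,\mathbf{v}_{F_{n-1}}\}\big)\not\subseteq\partial P\bigg\}\bigg|,$$ where the $F_i$ range over nonempty faces of $P$ (with $P$ itself allowed).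
   Context: A $d$-polytope is a $d$-dimensional convex hull of finitely many points in some $\mathbb{R}^e$. $\partial P$ is the union of the proper faces of $P$. Apexes: let $\mathbf{c}\mathbf{x}$ be a linear function taking distinct values at distinct vertexes of $P$. For each nonempty face $F$ of $P$ (including $P$) let the apex $\mathbf{v}_F$ be the unique vertex of $F$ at which $\mathbf{c}\mathbf{x}$ attains its minimum on $F$; $V(P)$ denotes this system of apexes. Polytope numbers: let $\mathcal{F}(P)$ be the set of nonempty faces of $P$, including $P$. The $V(P)$-polytope numbers $P(n)$ and interior polytope numbers $P(n)^\sharp$ are defined by double induction on $d=\dim P$ and $n\ge0$ (each face is a polytope with the inherited apexes): if $d=0$, $P(0)=P(0)^\sharp=0$ and $P(n)=P(n)^\sharp=1$ for $n\ge1$; if $d\ge1$, $P(0)=0$, $P(1)=1$, $P(0)^\sharp=P(1)^\sharp=0$, and for $n\ge2$ $$P(n)=P(n-1)+\sum_{F\in\mathcal{F}(P),\ \mathbf{v}_P\notin F}F(n)^\sharp,\qquad P(n)^\sharp=P(n)-\sum_{F\in\mathcal{F}(P)\setminus\{P\}}F(n)^\sharp .$$ -}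

module Defs where

open import Level using (0ℓ)
open import Algebra.Structures using (IsCommutativeRing)
open import Data.Empty using (⊥-elim)
open import Data.Fin using (Fin)
open import Data.Fin.Subset as Subset using (Subset; inside; outside; Nonempty; ∣_∣)
open import Data.Fin.Subset.Properties using (_⊂?_)
open import Data.Fin.Subset.Induction using (⊂-wellFounded)
open import Data.Integer as ℤ using (ℤ; +_)
open import Data.List as List using (List; []; _∷_; _++_)
open import Data.List.Extrema.Nat using (max)
open import Data.List.Membership.Propositional using (_∈_)
open import Data.List.Relation.Unary.Unique.Propositional using (Unique)
open import Data.Maybe as Maybe using ()
open import Data.Nat using (ℕ; zero; suc; _∸_)
open import Data.Product using (∃; ∃-syntax; Σ-syntax; _×_; _,_)
open import Data.Sum using (_⊎_; inj₁; inj₂)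
open import Data.Vec as Vec using (Vec; []; _∷_; lookup; zipWith; replicate)
open import Data.Vec.Relation.Unary.All using (All)
open import Data.Vec.Relation.Unary.Linked using (Linked)
open import Function.Bundles using (_⇔_)
open import Induction.WellFounded using (Acc; acc)
open import Relation.Binary.Definitions using (tri<; tri≈; tri>)
open import Relation.Binary.PropositionalEquality using (_≡_; _≢_; refl; sym)
open import Relation.Binary.Structures using (IsStrictTotalOrder)
open import Relation.Nullary using (¬_; Dec; yes; no)
open import Relation.Nullary.Decidable using (dec⇒maybe)
open import Relation.Unary using (Pred; _⊇_; _≐_; _∉_; ｛_｝)

-- z is the number of elements of the finite set S.
infix 4 _≡∣_∣
_≡∣_∣ : {A : Set} → ℤ → Pred A 0ℓ → Set
z ≡∣ S ∣ = ∃[ xs ] Unique xs × (∀ x → x ∈ xs ⇔ S x) × z ≡ + List.length xs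

-- The real numbers, characterised (up to isomorphism) as a complete
-- linearly ordered field.
record Reals : Set₁ where
  infix  8 -_
  infixl 7 _*_
  infixl 6 _+_
  infix  4 _<_ _≤_
  field
    ℝ                  : Set
    _+_ _*_            : ℝ → ℝ → ℝ
    -_                 : ℝ → ℝ
    0# 1#              : ℝ
    _<_                : ℝ → ℝ → Set
    isCommutativeRing  : IsCommutativeRing _≡_ _+_ _*_ -_ 0# 1#
    inverse            : ∀ x → x ≢ 0# → ∃[ y ] x * y ≡ 1#
    isStrictTotalOrder : IsStrictTotalOrder _≡_ _<_
    0<1                : 0# < 1#
    +-monoˡ-<          : ∀ {x y} z → x < y → x + z < y + z
    *-pos              : ∀ {x y} → 0# < x → 0# < y → 0# < x * y

  _≤_ : ℝ → ℝ → Set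
  x ≤ y = x < y ⊎ x ≡ y

  IsSupremum : Pred ℝ 0ℓ → ℝ → Set
  IsSupremum S s = (∀ x → S x → x ≤ s) × (∀ b → b < s → ∃[ x ] S x × b < x)

  field
    complete : (S : Pred ℝ 0ℓ) → ∃[ x ] S x → ∃[ u ] (∀ x → S x → x ≤ u) →
               ∃[ s ] IsSupremum S s

  open IsStrictTotalOrder isStrictTotalOrder public using (compare)

  -- Excluded middle is a consequence of completeness: consider the supremum
  -- of {0} ∪ {1 ∣ A}.
  lem : (A : Set) → Dec A
  lem A = decide (complete S (0# , inj₁ refl) (1# , ≤1))
    where
    S : Pred ℝ 0ℓ
    S x = x ≡ 0# ⊎ (x ≡ 1# × A)

    ≤1 : ∀ x → S x → x ≤ 1#
    ≤1 _ (inj₁ refl)       = inj₁ 0<1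
    ≤1 _ (inj₂ (refl , _)) = inj₂ refl

    open IsStrictTotalOrder isStrictTotalOrder using (irrefl; asym; trans)

    1≰ : ∀ {s} → s ≤ 0# → ¬ 1# ≤ s
    1≰ (inj₁ s<0)  (inj₁ 1<s)  = asym 0<1 (trans 1<s s<0)
    1≰ (inj₁ s<0)  (inj₂ refl) = asym 0<1 s<0
    1≰ (inj₂ refl) (inj₁ 1<0)  = asym 0<1 1<0
    1≰ (inj₂ refl) (inj₂ 1≡0)  = irrefl (sym 1≡0) 0<1

    decide : ∃[ s ] IsSupremum S s → Dec A
    decide (s , above , approx) with compare 0# s
    ... | tri≈ _ 0≡s _ = no λ a → 1≰ (inj₂ (sym 0≡s)) (above 1# (inj₂ (refl , a)))
    ... | tri> _ _ s<0 = no λ a → 1≰ (inj₁ s<0) (above 1# (inj₂ (refl , a)))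
    ... | tri< 0<s _ _ with approx 0# 0<s
    ...   | _ , inj₁ x≡0     , 0<x = ⊥-elim (irrefl (sym x≡0) 0<x)
    ...   | _ , inj₂ (_ , a) , _   = yes a

module Geometry (𝓡 : Reals) where
  open Reals 𝓡

  Point : ℕ → Set
  Point e = Vec ℝ e

  𝟎 : ∀ {e} → Point e
  𝟎 = replicate _ 0#

  infixr 7 _·_
  _·_ : ∀ {e} → Point e → Point e → ℝ
  a · x = Vec.foldr _ _+_ 0# (zipWith _*_ a x)

  sumℝ : ∀ {k} → Vec ℝ k → ℝ
  sumℝ = Vec.foldr _ _+_ 0#

  sumᵥ : ∀ {e k} → Vec (Point e) k → Point e
  sumᵥ = Vec.foldr _ (zipWith _+_) 𝟎

  combination : ∀ {e k} → Vec ℝ k → Vec (Point e) k → Point e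
  combination w q = sumᵥ (zipWith (λ t → Vec.map (t *_)) w q)

  conv : ∀ {e} → Pred (Point e) 0ℓ → Pred (Point e) 0ℓ
  conv {e} S x = ∃[ k ] Σ[ w ∈ Vec ℝ k ] Σ[ q ∈ Vec (Point e) k ]
    All (0# ≤_) w × sumℝ w ≡ 1# × All S q × combination w q ≡ x

  -- The faces of Q are the sets {x ∈ Q : a·x = b} with a·x ≤ b valid on Q;
  -- a = 0 is allowed, so Q itself is a face.
  infix 4 _FaceOf_
  _FaceOf_ : ∀ {e} → Pred (Point e) 0ℓ → Pred (Point e) 0ℓ → Set
  _FaceOf_ {e} F Q = Σ[ a ∈ Point e ] ∃[ b ]
    (∀ x → Q x → a · x ≤ b) × F ≐ (λ x → Q x × a · x ≡ b)

  IsVertex : ∀ {e} → Pred (Point e) 0ℓ → Point e → Set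
  IsVertex Q v = ｛ v ｝ FaceOf Q

  DistinctOnVertices : ∀ {e} → Point e → Pred (Point e) 0ℓ → Set
  DistinctOnVertices c Q = ∀ u v → IsVertex Q u → IsVertex Q v → c · u ≡ c · v → u ≡ v

  IsApex : ∀ {e} → Point e → Pred (Point e) 0ℓ → Point e → Set
  IsApex c Q v = IsVertex Q v × (∀ x → Q x → c · v ≤ c · x)

  subsets : ∀ m → List (Subset m)
  subsets zero    = [] ∷ []
  subsets (suc m) = List.map (inside ∷_) (subsets m) ++ List.map (outside ∷_) (subsets m)

  -- All polytopes below are spanned by some of the points p (which need be
  -- neither distinct nor vertices); U : Subset m stands for conv {pᵢ : i ∈ U}.
  -- The linear function is x ↦ c · x.
  module Polytopes {e m : ℕ} (p : Vec (Point e) m) (c : Point e) where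

    body : Subset m → Pred (Point e) 0ℓ
    body U = conv (λ x → ∃[ i ] i Subset.∈ U × lookup p i ≡ x)

    AffinelyIndependent : Subset m → Set
    AffinelyIndependent T = (w : Vec ℝ m) → (∀ i → i Subset.∉ T → lookup w i ≡ 0#) →
      sumℝ w ≡ 0# → combination w p ≡ 𝟎 → w ≡ replicate _ 0#

    -- The dimension of the affine hull: one less than the largest number of
    -- affinely independent points among those spanning it.
    dim : Subset m → ℕ
    dim U = max 0 (List.map (λ T → ∣ T ∣ ∸ 1)
      (List.filter (λ T → lem (T Subset.⊆ U × AffinelyIndependent T)) (subsets m)))

    -- A nonempty face of U is recorded by the set of all spanning points of U
    -- lying on it; the last condition makes this encoding unique.
    record IsNonemptyFace (U F : Subset m) : Set where
      field
        ⊆-whole   : F Subset.⊆ U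
        nonempty  : Nonempty F
        isFace    : body F FaceOf body U
        saturated : ∀ i → i Subset.∈ U → body F (lookup p i) → i Subset.∈ F

    faces : Subset m → List (Subset m)
    faces U = List.filter (λ F → lem (IsNonemptyFace U F)) (subsets m)

    ∂ : Subset m → Pred (Point e) 0ℓ
    ∂ U x = ∃[ F ] F ∈ faces U × F ≢ U × body F x

    -- The default value is never reached when U is nonempty and c takes
    -- distinct values at distinct vertices.
    apex : Subset m → Point e
    apex U with lem (∃ (IsApex c (body U)))
    ... | yes (v , _) = v
    ... | no  _       = 𝟎

    -- The sum of f F over the F in the list with F ⊂ U. For faces F of U,
    -- F ⊂ U just says F ≢ U; the proof serves the recursion below.
    sumBelow : (U : Subset m) → List (Subset m) → (∀ F → F Subset.⊂ U → ℤ) → ℤ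
    sumBelow U Fs f = List.foldr ℤ._+_ (+ 0) (List.mapMaybe
      (λ F → Maybe.map (f F) (dec⇒maybe (F ⊂? U))) Fs)

    -- The first argument is always dim U. Faces avoiding apex U are
    -- automatically ≢ U. Recursion is on U (by ⊂, in place of dimension)
    -- and n.
    number   : ℕ → (U : Subset m) → Acc Subset._⊂_ U → ℕ → ℤ
    interior : ℕ → (U : Subset m) → Acc Subset._⊂_ U → ℕ → ℤ

    number zero    U _            zero    = + 0
    number zero    U _            (suc n) = + 1
    number (suc d) U _            0       = + 0
    number (suc d) U _            1       = + 1
    number (suc d) U a@(acc rs) (suc n@(suc _)) =
      number (suc d) U a n ℤ.+
      sumBelow U (List.filter (λ F → lem (apex U ∉ body F)) (faces U))
        (λ F F⊂U → interior (dim F) F (rs F⊂U) (suc n))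

    interior zero    U _          zero    = + 0
    interior zero    U _          (suc n) = + 1
    interior (suc d) U _          0       = + 0
    interior (suc d) U _          1       = + 0
    interior (suc d) U a@(acc rs) n@(suc (suc _)) =
      number (suc d) U a n ℤ.-
      sumBelow U (faces U) (λ F F⊂U → interior (dim F) F (rs F⊂U) n)

    polytopeNumber : Subset m → ℕ → ℤ
    polytopeNumber U = number (dim U) U (⊂-wellFounded U)

    interiorPolytopeNumber : Subset m → ℕ → ℤ
    interiorPolytopeNumber U = interior (dim U) U (⊂-wellFounded U)

    -- F₁ ⊇ F₂ ⊇ ⋯ ⊇ Fₖ, all nonempty faces of U.
    IsFaceChain : ∀ {k} → Subset m → Vec (Subset m) k → Set
    IsFaceChain U Fs = All (_∈ faces U) Fs × Linked (λ F G → body F ⊇ body G) Fs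

{-# OPTIONS --safe #-}
-- Write S_U(k) for the set of k-fold sums of apexes along chains of faces of U, and
-- S♯_U(k) for those sums whose apexes lie in no common proper face of U. If two k-tuples
-- of points of U have the same sum and a face contains one tuple, then it contains the
-- other: the supporting functional of the face attains its maximum on the sum only if it
-- does so on every summand. Together with the fact that intersecting a chain with a face
-- containing its apexes does not change the apexes, this shows for k ≥ 1 that S_U(k) is the
-- disjoint union of the sets S♯_F(k) over all faces F. Moreover S_U(k+1) is the disjoint
-- union of v_U + S_U(k), which is the set of sums whose face F contains v_U, and of the
-- S♯_F(k+1) with v_U ∉ F. These are the two recursions defining the polytope numbers.
module Submission where

open import Defs
open import Algebra.Bundles using (CommutativeRing)
import Algebra.Properties.Ring as RingProperties
open import Data.Fin using (Fin; zero; suc)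
open import Data.Fin.Properties as Fin using ()
open import Data.Fin.Subset as Subset using (Subset; inside; outside; Nonempty; _∩_; ⁅_⁆; ∣_∣; ⊤)
open import Data.Fin.Subset.Induction using (⊂-wellFounded)
open import Data.Fin.Subset.Properties
  using (_⊂?_; nonempty?; ⊆-antisym; _∈?_; x∈p∩q⁺; p∩q⊆p; p∩q⊆q; x∈⁅x⁆; x∈⁅y⁆⇒x≡y; x∈p∪q⁻; x∈p∪q⁺
        ; x∈p⇒∣p-x∣<∣p∣; x∈p∧x≢y⇒x∈p-y; ∈⊤)
open import Data.Integer as ℤ using (ℤ; +_)
open import Data.Integer.Properties as ℤ using ()
open import Algebra.Properties.AbelianGroup ℤ.+-0-abelianGroup using (xyx⁻¹≈y)
open import Data.List as List using (List; []; _∷_; _++_)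
open import Data.List.Extrema.Nat using (xs≤max)
open import Data.List.Membership.Propositional as List using ()
open import Data.List.Membership.Propositional.Properties
  using (∈-++⁺ˡ; ∈-++⁺ʳ; ∈-++⁻; ∈-map⁺; ∈-map⁻; ∈-filter⁺; ∈-filter⁻)
open import Data.List.Membership.Propositional.Properties.WithK using (unique∧set⇒bag)
open import Data.List.Properties as List using ()
open import Data.List.Relation.Binary.BagAndSetEquality using (∼bag⇒↭)
open import Data.List.Relation.Binary.Permutation.Propositional.Properties using (↭-length)
open import Data.List.Relation.Unary.All as ListAll using ()
open import Data.List.Relation.Unary.AllPairs using ([]; _∷_)
open import Data.List.Relation.Unary.Any using (here; there)
open import Data.List.Relation.Unary.Unique.Propositional using (Unique)
open import Data.List.Relation.Unary.Unique.Propositional.Properties as Unique using ()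
open import Data.Nat as ℕ using (ℕ; zero; suc; s≤s; z≤n)
open import Data.Nat.Properties as ℕ using ()
open import Data.Product using (∃; ∃-syntax; Σ-syntax; _×_; _,_; proj₁; proj₂)
open import Data.Sum using (inj₁; inj₂; [_,_]′)
open import Data.Vec as Vec using (Vec; []; _∷_; lookup; zipWith; replicate; tabulate)
open import Data.Vec.Membership.Propositional as Vec using ()
open import Data.Vec.Membership.Propositional.Properties using (∈-lookup)
open import Data.Vec.Properties
  using (lookup⇒[]=; []=⇒lookup; lookup∘tabulate; tabulate∘lookup; tabulate-cong; lookup-zipWith; lookup-replicate)
open import Data.Vec.Relation.Unary.All as All using (All; []; _∷_)
open import Data.Vec.Relation.Unary.All.Properties as All using ()
open import Data.Vec.Relation.Unary.Linked as Linked using (Linked; []; [-]; _∷_)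
open import Function using (_∘_; case_of_)
open import Function.Bundles using (_⇔_; mk⇔; Equivalence)
open import Induction.WellFounded using (Acc; acc)
open import Level using (0ℓ)
open import Relation.Binary.Bundles using (TotalOrder)
open import Relation.Binary.Definitions using (tri<; tri≈; tri>)
open import Relation.Binary.PropositionalEquality
open import Relation.Binary.Structures using (IsStrictTotalOrder)
open import Relation.Nullary using (¬_; yes; no; does)
open import Relation.Nullary.Decidable using (dec-true; decidable-stable; _×-dec_; ¬?)
open import Relation.Nullary.Negation using (contradiction)
open import Relation.Unary as Unary
  using (Pred; Decidable; _≐_; _⊆_; _⊇_; _⊈_; _∪_; ∁; ∅; _∉_; ｛_｝)
open Equivalence using (to; from)

-- The numbers are defined by descending into a face `F`, where faces and apexes are computed afresh
-- from `F` alone. The counts therefore need faces of `F` to be faces of `U`, faces of `U` lying in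
-- `F` to be faces of `F`, and vertices of `F` to be vertices of `U`. The first and the third
-- require a functional perturbed by another one, N a + a′ with N large. For this reason faces are
-- handled as systems of inequalities at the finitely many spanning points: each point bounds N from
-- below, and the largest bound will do. Distinct chains may have the same sum, so the smallest face
-- has to be determined by the sum and not by the chain. This fails for the empty sum, which is
-- interior to every vertex; hence the interior count starts with chains of length 1. Dimension
-- enters the counts through one fact: in dimension 0 all spanning points coincide, since two
-- distinct ones would be affinely independent.

-- Cardinalities of finite sets.

module _ {A : Set} where

  ∣∣-cong : ∀ {z} {S T : Pred A 0ℓ} → S ≐ T → z ≡∣ S ∣ → z ≡∣ T ∣
  ∣∣-cong (S⊆T , T⊆S) (xs , xs! , xs≐S , z≡) =
    xs , xs! , (λ x → mk⇔ (S⊆T ∘ to (xs≐S x)) (from (xs≐S x) ∘ T⊆S)) , z≡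

  ∣∣-unique : ∀ {y z} {S : Pred A 0ℓ} → y ≡∣ S ∣ → z ≡∣ S ∣ → y ≡ z
  ∣∣-unique (xs , xs! , xs≐S , refl) (ys , ys! , ys≐S , refl) =
    cong +_ (↭-length (∼bag⇒↭ (unique∧set⇒bag xs! ys!
      (λ {x} → mk⇔ (from (ys≐S x) ∘ to (xs≐S x)) (from (xs≐S x) ∘ to (ys≐S x))))))

  ∣∅∣ : + 0 ≡∣ ∅ {A = A} ∣
  ∣∅∣ = [] , [] , (λ x → mk⇔ (λ ()) (λ ())) , refl

  ∣｛｝∣ : ∀ (a : A) → + 1 ≡∣ ｛ a ｝ ∣
  ∣｛｝∣ a = a ∷ [] , ListAll.[] ∷ [] ,
    (λ x → mk⇔ (λ { (here refl) → refl }) (λ { refl → here refl })) , refl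

  ∣∪∣ : ∀ {y z} {S T : Pred A 0ℓ} → (∀ {x} → S x → ¬ T x) →
        y ≡∣ S ∣ → z ≡∣ T ∣ → y ℤ.+ z ≡∣ S ∪ T ∣
  ∣∪∣ disjoint (xs , xs! , xs≐S , refl) (ys , ys! , ys≐T , refl) =
    xs ++ ys ,
    Unique.++⁺ xs! ys! (λ { (x∈xs , x∈ys) → disjoint (to (xs≐S _) x∈xs) (to (ys≐T _) x∈ys) }) ,
    (λ x → mk⇔
      (λ x∈ → case ∈-++⁻ xs x∈ of λ where
        (inj₁ x∈xs) → inj₁ (to (xs≐S x) x∈xs)
        (inj₂ x∈ys) → inj₂ (to (ys≐T x) x∈ys))
      [ ∈-++⁺ˡ ∘ from (xs≐S x) , ∈-++⁺ʳ xs ∘ from (ys≐T x) ]′) ,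
    cong +_ (sym (List.length-++ xs))

  -- The difference is enumerated by filtering the list of `S`. That its length is `y ℤ.- z` follows
  -- from additivity over disjoint unions and `∣∣-unique`.
  ∣∖∣ : ∀ {y z} {S T : Pred A 0ℓ} → Decidable T → T ⊆ S →
        y ≡∣ S ∣ → z ≡∣ T ∣ → y ℤ.- z ≡∣ S Unary.∩ ∁ T ∣
  ∣∖∣ {y} {z} {S} {T} T? T⊆S ∣S∣@(xs , xs! , xs≐S , _) ∣T∣ =
    subst (_≡∣ S Unary.∩ ∁ T ∣) (sym y-z≡) rest
    where
    zs = List.filter (¬? ∘ T?) xs

    rest : + List.length zs ≡∣ S Unary.∩ ∁ T ∣
    rest = zs , Unique.filter⁺ (¬? ∘ T?) xs! ,
      (λ x → mk⇔
        (λ x∈ → case ∈-filter⁻ (¬? ∘ T?) {xs = xs} x∈ of λ (x∈xs , x∉T) → to (xs≐S x) x∈xs , x∉T)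
        (λ (x∈S , x∉T) → ∈-filter⁺ (¬? ∘ T?) (from (xs≐S x) x∈S) x∉T)) , refl

    split : T ∪ (S Unary.∩ ∁ T) ≐ S
    split = [ T⊆S , proj₁ ]′ , λ {x} x∈S → case T? x of λ where
      (yes x∈T) → inj₁ x∈T
      (no  x∉T) → inj₂ (x∈S , x∉T)

    y-z≡ : y ℤ.- z ≡ + List.length zs
    y-z≡ = begin
      y ℤ.- z                       ≡⟨ cong (λ i → i ℤ.- z) (∣∣-unique ∣S∣
                                         (∣∣-cong split (∣∪∣ (λ x∈T (_ , x∉T) → x∉T x∈T) ∣T∣ rest))) ⟩
      z ℤ.+ + List.length zs ℤ.- z  ≡⟨ xyx⁻¹≈y z (+ List.length zs) ⟩
      + List.length zs              ∎
      where open ≡-Reasoning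

  ∣map∣ : ∀ {B : Set} {z} {S : Pred A 0ℓ} (f : A → B) → (∀ {x y} → f x ≡ f y → x ≡ y) →
          z ≡∣ S ∣ → z ≡∣ (λ y → ∃[ x ] S x × f x ≡ y) ∣
  ∣map∣ f inj (xs , xs! , xs≐S , refl) = List.map f xs , Unique.map⁺ inj xs! ,
    (λ y → mk⇔
      (λ y∈ → case ∈-map⁻ f y∈ of λ (x , x∈xs , y≡fx) → x , to (xs≐S x) x∈xs , sym y≡fx)
      (λ { (x , x∈S , refl) → ∈-map⁺ f (from (xs≐S x) x∈S) })) ,
    cong +_ (sym (List.length-map f xs))

-- Enumeration of subsets, and sums over proper subsets as cardinalities.

module FiniteSums (𝓡 : Reals) where
  open Geometry 𝓡

  ∈-subsets : ∀ {m} (F : Subset m) → F List.∈ subsets m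
  ∈-subsets Vec.[]              = here refl
  ∈-subsets (inside  Vec.∷ F)   = ∈-++⁺ˡ (∈-map⁺ _ (∈-subsets F))
  ∈-subsets (outside Vec.∷ F)   = ∈-++⁺ʳ _ (∈-map⁺ _ (∈-subsets F))

  subsets-unique : ∀ m → Unique (subsets m)
  subsets-unique zero    = ListAll.[] ∷ []
  subsets-unique (suc m) = Unique.++⁺
    (Unique.map⁺ (λ { refl → refl }) (subsets-unique m))
    (Unique.map⁺ (λ { refl → refl }) (subsets-unique m))
    (λ (F∈₁ , F∈₂) → case (∈-map⁻ _ F∈₁ , ∈-map⁻ _ F∈₂) of λ { ((_ , _ , refl) , (_ , _ , ())) })

  module _ {e m} (p : Vec (Point e) m) (c : Point e) {A : Set} where
    open Polytopes p c

    -- Disjointness is phrased as "a common element forces equal indices", the form in which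
    -- `carrier-unique` supplies it. List entries that are not below `U` contribute to neither side.
    ∣sumBelow∣ : ∀ U Fs (f : ∀ F → F Subset.⊂ U → ℤ) (S : Subset m → Pred A 0ℓ) → Unique Fs →
      (∀ {F G x} → F List.∈ Fs → G List.∈ Fs → S F x → S G x → F ≡ G) →
      (∀ {F} (F⊂U : F Subset.⊂ U) → F List.∈ Fs → f F F⊂U ≡∣ S F ∣) →
      sumBelow U Fs f ≡∣ (λ x → ∃[ F ] F List.∈ Fs × F Subset.⊂ U × S F x) ∣
    ∣sumBelow∣ U [] f S _ _ _ = ∣∣-cong ((λ ()) , λ { (_ , () , _) }) ∣∅∣
    ∣sumBelow∣ U (F ∷ Fs) f S (F∉Fs ∷ Fs!) disjoint ∣f∣
      with ∣sumBelow∣ U Fs f S Fs! (λ G∈ H∈ → disjoint (there G∈) (there H∈)) (λ G⊂U G∈ → ∣f∣ G⊂U (there G∈))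
         | F ⊂? U
    ... | ∣Fs∣ | no  F⊄U = ∣∣-cong
      ( (λ { (G , G∈ , rest) → G , there G∈ , rest })
      , (λ { (G , here refl , F⊂U , _) → contradiction F⊂U F⊄U
           ; (G , there G∈ , rest)     → G , G∈ , rest })) ∣Fs∣
    ... | ∣Fs∣ | yes F⊂U = ∣∣-cong
      ( (λ { (inj₁ x∈F)              → F , here refl , F⊂U , x∈F
           ; (inj₂ (G , G∈ , rest)) → G , there G∈ , rest })
      , (λ { (G , here refl , _ , x∈F) → inj₁ x∈F
           ; (G , there G∈ , rest)     → inj₂ (G , G∈ , rest) }))
      (∣∪∣ (λ { x∈F (G , G∈ , _ , x∈G) →
                ListAll.lookup F∉Fs G∈ (disjoint (here refl) (there G∈) x∈F x∈G) })
           (∣f∣ F⊂U (here refl)) ∣Fs∣)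

-- Arithmetic of ordered fields.

module OrderedField (𝓡 : Reals) where
  open Reals 𝓡 public
  open IsStrictTotalOrder isStrictTotalOrder public
    using () renaming (irrefl to <-irrefl; trans to <-trans; asym to <-asym)

  commutativeRing : CommutativeRing 0ℓ 0ℓ
  commutativeRing = record { isCommutativeRing = isCommutativeRing }

  open CommutativeRing commutativeRing public
    using (+-identityˡ; +-identityʳ; +-comm; +-assoc; *-comm; *-assoc; *-identityˡ; *-identityʳ
          ; zeroˡ; zeroʳ; distribˡ; distribʳ; -‿inverseʳ; ring; commutativeSemiring; +-commutativeSemigroup)

  open RingProperties ring public using (-1*x≈-x; +-cancelˡ; +-cancelʳ; x∙y⁻¹≈ε⇒x≈y; //-rightDividesˡ)
  open RingProperties ring using (-‿distribˡ-*; -‿distribʳ-*; -‿involutive; \\-leftDividesʳ)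
  open import Algebra.Solver.Ring.NaturalCoefficients.Default commutativeSemiring public
    using (solve; _:+_; _:*_; _:=_)

  open import Algebra.Properties.CommutativeSemigroup +-commutativeSemigroup public
    using () renaming (interchange to +-interchange)
  open import Relation.Binary.Construct.StrictToNonStrict _≡_ _<_ as NonStrict using ()

  ≤-totalOrder : TotalOrder 0ℓ 0ℓ 0ℓ
  ≤-totalOrder = record { isTotalOrder = NonStrict.isTotalOrder isStrictTotalOrder }

  open TotalOrder ≤-totalOrder public using () renaming
    (refl to ≤-refl; trans to ≤-trans; antisym to ≤-antisym; total to ≤-total)

  <⇒≱ : ∀ {x y} → x < y → ¬ y ≤ x
  <⇒≱ x<y (inj₁ y<x)  = <-asym x<y y<x
  <⇒≱ x<y (inj₂ refl) = <-irrefl refl x<y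

  +-monoʳ-< : ∀ {x y} z → x < y → z + x < z + y
  +-monoʳ-< z x<y = subst₂ _<_ (+-comm _ z) (+-comm _ z) (+-monoˡ-< z x<y)

  +-mono-≤ : ∀ {x y u v} → x ≤ y → u ≤ v → x + u ≤ y + v
  +-mono-≤ x≤y u≤v = ≤-trans (left x≤y) (right u≤v)
    where
    left : ∀ {x y z} → x ≤ y → x + z ≤ y + z
    left (inj₁ x<y)  = inj₁ (+-monoˡ-< _ x<y)
    left (inj₂ refl) = inj₂ refl
    right : ∀ {x y z} → x ≤ y → z + x ≤ z + y
    right (inj₁ x<y)  = inj₁ (+-monoʳ-< _ x<y)
    right (inj₂ refl) = inj₂ refl

  +-mono-<-≤ : ∀ {x y u v} → x < y → u ≤ v → x + u < y + v
  +-mono-<-≤ x<y (inj₁ u<v)  = <-trans (+-monoˡ-< _ x<y) (+-monoʳ-< _ u<v)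
  +-mono-<-≤ x<y (inj₂ refl) = +-monoˡ-< _ x<y

  -- The tightness arguments below rest on this: a bound attained by a sum is attained by each
  -- summand.
  +-tight : ∀ {x y u v} → x ≤ y → u ≤ v → x + u ≡ y + v → x ≡ y × u ≡ v
  +-tight (inj₁ x<y)  u≤v         eq = contradiction (+-mono-<-≤ x<y u≤v) (<-irrefl eq)
  +-tight (inj₂ refl) (inj₁ u<v)  eq = contradiction (+-monoʳ-< _ u<v) (<-irrefl eq)
  +-tight (inj₂ refl) (inj₂ refl) eq = refl , refl

  0<y-x : ∀ {x y} → x < y → 0# < y + - x
  0<y-x {x} x<y = subst (_< _) (-‿inverseʳ x) (+-monoˡ-< (- x) x<y)

  neg-cancel-≤ : ∀ {x y} → - x ≤ - y → y ≤ x
  neg-cancel-≤ {x} {y} -x≤-y = subst₂ _≤_ (\\-leftDividesʳ x y)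
    (trans (cong (_+_ (- y)) (+-comm x y)) (\\-leftDividesʳ y x)) (+-mono-≤ -x≤-y (≤-refl {x + y}))

  *-monoʳ-< : ∀ {t x y} → 0# < t → x < y → t * x < t * y
  *-monoʳ-< {t} {x} {y} 0<t x<y = subst₂ _<_ (+-identityˡ _)
    (trans (sym (distribˡ t (y + - x) x)) (cong (t *_) (//-rightDividesˡ x y)))
    (+-monoˡ-< (t * x) (*-pos 0<t (0<y-x x<y)))

  *-monoʳ-≤ : ∀ {t x y} → 0# ≤ t → x ≤ y → t * x ≤ t * y
  *-monoʳ-≤ 0≤t         (inj₂ refl) = inj₂ refl
  *-monoʳ-≤ (inj₁ 0<t)  (inj₁ x<y)  = inj₁ (*-monoʳ-< 0<t x<y)
  *-monoʳ-≤ (inj₂ refl) (inj₁ x<y)  = inj₂ (trans (zeroˡ _) (sym (zeroˡ _)))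

  *-tight : ∀ {t x y} → 0# < t → x ≤ y → t * x ≡ t * y → x ≡ y
  *-tight 0<t (inj₁ x<y) eq = contradiction (*-monoʳ-< 0<t x<y) (<-irrefl eq)
  *-tight 0<t (inj₂ x≡y) eq = x≡y

  *-nonneg : ∀ {x y} → 0# ≤ x → 0# ≤ y → 0# ≤ x * y
  *-nonneg 0≤x 0≤y = subst (_≤ _) (zeroʳ _) (*-monoʳ-≤ 0≤x 0≤y)

  positive-inverse : ∀ {x} → 0# < x → ∃[ y ] 0# < y × x * y ≡ 1#
  positive-inverse {x} 0<x with inverse x (λ { refl → <-irrefl refl 0<x })
  ... | y , xy≡1 with compare 0# y
  ...   | tri< 0<y _ _ = y , 0<y , xy≡1
  ...   | tri≈ _ refl _ = contradiction 0<1 (<-irrefl (trans (sym (zeroʳ x)) xy≡1))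
  ...   | tri> _ _ y<0 = contradiction (subst₂ _<_ xy≡1 (zeroʳ x) (*-monoʳ-< 0<x y<0)) (<-asym 0<1)

  x*y≡0⇒x≡0 : ∀ {x y} → y ≢ 0# → x * y ≡ 0# → x ≡ 0#
  x*y≡0⇒x≡0 {x} {y} y≢0 xy≡0 with inverse y y≢0
  ... | z , yz≡1 = begin
    x            ≡⟨ *-identityʳ x ⟨
    x * 1#       ≡⟨ cong (x *_) yz≡1 ⟨
    x * (y * z)  ≡⟨ *-assoc x y z ⟨
    x * y * z    ≡⟨ cong (_* z) xy≡0 ⟩
    0# * z       ≡⟨ zeroˡ z ⟩
    0#           ∎
    where open ≡-Reasoning

  square-nonneg : ∀ x → 0# ≤ x * x
  square-nonneg x with compare 0# x
  ... | tri< 0<x _ _ = inj₁ (*-pos 0<x 0<x)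
  ... | tri≈ _ refl _ = inj₂ (sym (zeroˡ 0#))
  ... | tri> _ _ x<0 = inj₁ (subst (0# <_) (trans (sym (-‿distribˡ-* x (- x)))
    (trans (cong -_ (sym (-‿distribʳ-* x x))) (-‿involutive (x * x)))) (*-pos 0<-x 0<-x))
    where
    0<-x : 0# < - x
    0<-x = subst (0# <_) (+-identityˡ (- x)) (0<y-x x<0)

  square-zero : ∀ {x} → x * x ≡ 0# → x ≡ 0#
  square-zero {x} xx≡0 with compare x 0#
  ... | tri≈ _ x≡0 _ = x≡0
  ... | tri< _ x≢0 _ = x*y≡0⇒x≡0 x≢0 xx≡0
  ... | tri> _ x≢0 _ = x*y≡0⇒x≡0 x≢0 xx≡0

-- Inner products, linear combinations and convex hulls.

module LinearAlgebra (𝓡 : Reals) where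
  open OrderedField 𝓡 public
  open Geometry 𝓡 public

  infixl 6 _⊕_
  _⊕_ : ∀ {e} → Point e → Point e → Point e
  _⊕_ = zipWith _+_

  infixr 7 _⊛_
  _⊛_ : ∀ {e} → ℝ → Point e → Point e
  t ⊛ x = Vec.map (t *_) x

  ·-zeroʳ : ∀ {e} (a : Point e) → a · 𝟎 ≡ 0#
  ·-zeroʳ []       = refl
  ·-zeroʳ (a ∷ as) = trans (cong₂ _+_ (zeroʳ a) (·-zeroʳ as)) (+-identityʳ 0#)

  ·-comm : ∀ {e} (a b : Point e) → a · b ≡ b · a
  ·-comm []       []       = refl
  ·-comm (a ∷ as) (b ∷ bs) = cong₂ _+_ (*-comm a b) (·-comm as bs)

  ·-⊕ʳ : ∀ {e} (a x y : Point e) → a · (x ⊕ y) ≡ a · x + a · y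
  ·-⊕ʳ []       []       []       = sym (+-identityʳ 0#)
  ·-⊕ʳ (a ∷ as) (x ∷ xs) (y ∷ ys) =
    trans (cong (_+_ (a * (x + y))) (·-⊕ʳ as xs ys))
      (solve 5 (λ a x y r s → a :* (x :+ y) :+ (r :+ s) := (a :* x :+ r) :+ (a :* y :+ s)) refl
        a x y (as · xs) (as · ys))

  ·-⊛ʳ : ∀ {e} (a : Point e) t x → a · (t ⊛ x) ≡ t * (a · x)
  ·-⊛ʳ []       t []       = sym (zeroʳ t)
  ·-⊛ʳ (a ∷ as) t (x ∷ xs) = trans (cong (_+_ (a * (t * x))) (·-⊛ʳ as t xs))
    (solve 4 (λ a t x r → a :* (t :* x) :+ t :* r := t :* (a :* x :+ r)) refl a t x (as · xs))

  ·-⊕ˡ : ∀ {e} (a b x : Point e) → (a ⊕ b) · x ≡ a · x + b · x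
  ·-⊕ˡ a b x = trans (·-comm (a ⊕ b) x) (trans (·-⊕ʳ x a b) (cong₂ _+_ (·-comm x a) (·-comm x b)))

  ·-⊛ˡ : ∀ {e} t (a x : Point e) → (t ⊛ a) · x ≡ t * (a · x)
  ·-⊛ˡ t a x = trans (·-comm (t ⊛ a) x) (trans (·-⊛ʳ x t a) (cong (t *_) (·-comm x a)))

  neg : ∀ {e} → Point e → Point e
  neg a = (- 1#) ⊛ a

  neg-· : ∀ {e} (a x : Point e) → neg a · x ≡ - (a · x)
  neg-· a x = trans (·-⊛ˡ (- 1#) a x) (-1*x≈-x (a · x))

  ⊕-identityˡ : ∀ {e} (x : Point e) → 𝟎 ⊕ x ≡ x
  ⊕-identityˡ []       = refl
  ⊕-identityˡ (x ∷ xs) = cong₂ _∷_ (+-identityˡ x) (⊕-identityˡ xs)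

  ⊕-assoc : ∀ {e} (x y z : Point e) → (x ⊕ y) ⊕ z ≡ x ⊕ (y ⊕ z)
  ⊕-assoc []       []       []       = refl
  ⊕-assoc (x ∷ xs) (y ∷ ys) (z ∷ zs) = cong₂ _∷_ (+-assoc x y z) (⊕-assoc xs ys zs)

  ⊕-cancelˡ : ∀ {e} (x : Point e) {y z} → x ⊕ y ≡ x ⊕ z → y ≡ z
  ⊕-cancelˡ []       {[]}     {[]}     _  = refl
  ⊕-cancelˡ (x ∷ xs) {_ ∷ _} {_ ∷ _} eq =
    cong₂ _∷_ (+-cancelˡ x _ _ (cong Vec.head eq)) (⊕-cancelˡ xs (cong Vec.tail eq))

  ⊛-identityˡ : ∀ {e} (x : Point e) → 1# ⊛ x ≡ x
  ⊛-identityˡ []       = refl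
  ⊛-identityˡ (x ∷ xs) = cong₂ _∷_ (*-identityˡ x) (⊛-identityˡ xs)

  ⊛-zeroˡ : ∀ {e} (x : Point e) → 0# ⊛ x ≡ 𝟎
  ⊛-zeroˡ []       = refl
  ⊛-zeroˡ (x ∷ xs) = cong₂ _∷_ (zeroˡ x) (⊛-zeroˡ xs)

  ⊛-zeroʳ : ∀ {e} t → t ⊛ 𝟎 {e} ≡ 𝟎
  ⊛-zeroʳ {zero}  t = refl
  ⊛-zeroʳ {suc e} t = cong₂ _∷_ (zeroʳ t) (⊛-zeroʳ t)

  ⊛-distribˡ : ∀ {e} t (x y : Point e) → t ⊛ (x ⊕ y) ≡ t ⊛ x ⊕ t ⊛ y
  ⊛-distribˡ t []       []       = refl
  ⊛-distribˡ t (x ∷ xs) (y ∷ ys) = cong₂ _∷_ (distribˡ t x y) (⊛-distribˡ t xs ys)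

  ⊛-distribʳ : ∀ {e} s t (x : Point e) → (s + t) ⊛ x ≡ s ⊛ x ⊕ t ⊛ x
  ⊛-distribʳ s t []       = refl
  ⊛-distribʳ s t (x ∷ xs) = cong₂ _∷_ (distribʳ x s t) (⊛-distribʳ s t xs)

  ⊛-assoc : ∀ {e} s t (x : Point e) → (s * t) ⊛ x ≡ s ⊛ t ⊛ x
  ⊛-assoc s t []       = refl
  ⊛-assoc s t (x ∷ xs) = cong₂ _∷_ (*-assoc s t x) (⊛-assoc s t xs)

  -- This is `0 ≤ |x - y|²` together with its equality case, obtained coordinate by coordinate. It
  -- serves in place of the Cauchy-Schwarz inequality and avoids square roots.
  2x·y≤x·x+y·y : ∀ {e} (x y : Point e) →
    x · y + x · y ≤ x · x + y · y × (x · y + x · y ≡ x · x + y · y → x ≡ y)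
  2x·y≤x·x+y·y []       []       = inj₂ refl , λ _ → refl
  2x·y≤x·x+y·y (x ∷ xs) (y ∷ ys) with 2x·y≤x·x+y·y xs ys
  ... | tail≤ , tail-tight =
    subst₂ _≤_ lhs≡ rhs≡ (+-mono-≤ head≤ tail≤) ,
    λ eq → case +-tight head≤ tail≤ (trans lhs≡ (trans eq (sym rhs≡))) of λ (h , t) →
      cong₂ _∷_ (head-tight h) (tail-tight t)
    where
    square-expand : (x + - y) * (x + - y) + (x * y + x * y) ≡ x * x + y * y
    -- With x written as d + y, where d is `x + - y`, the claim becomes an identity of commutative
    -- semirings.
    square-expand = subst (λ x′ → (x + - y) * (x + - y) + (x′ * y + x′ * y) ≡ x′ * x′ + y * y)
      (//-rightDividesˡ y x)
      (solve 2 (λ d y → d :* d :+ ((d :+ y) :* y :+ (d :+ y) :* y) := (d :+ y) :* (d :+ y) :+ y :* y) refl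
        (x + - y) y)

    head≤ : x * y + x * y ≤ x * x + y * y
    head≤ = subst₂ _≤_ (+-identityˡ _) square-expand (+-mono-≤ (square-nonneg (x + - y)) ≤-refl)

    head-tight : x * y + x * y ≡ x * x + y * y → x ≡ y
    head-tight eq = x∙y⁻¹≈ε⇒x≈y x y (square-zero
      (+-cancelʳ _ _ 0# (trans square-expand (trans (sym eq) (sym (+-identityˡ _))))))


    lhs≡ = +-interchange (x * y) (x * y) (xs · ys) (xs · ys)
    rhs≡ = +-interchange (x * x) (y * y) (xs · xs) (ys · ys)

  -- Here `2x·y = 2x·x ≥ x·x + y·y`, which is the equality case above. Thus among points no farther
  -- from the origin than `x`, the functional `x ·_` is maximal at `x` alone.
  x·y≡x·x⇒x≡y : ∀ {e} {x y : Point e} → y · y ≤ x · x → x · y ≡ x · x → x ≡ y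
  x·y≡x·x⇒x≡y {x = x} {y} y·y≤x·x x·y≡x·x = proj₂ (2x·y≤x·x+y·y x y)
    (≤-antisym (proj₁ (2x·y≤x·x+y·y x y))
      (subst (x · x + y · y ≤_) (cong₂ _+_ (sym x·y≡x·x) (sym x·y≡x·x)) (+-mono-≤ ≤-refl y·y≤x·x)))

  x·y≤x·x : ∀ {e} {x y : Point e} → y · y ≤ x · x → x · y ≤ x · x
  x·y≤x·x {x = x} {y} y·y≤x·x with ≤-total (x · y) (x · x)
  ... | inj₁ ≤        = ≤
  ... | inj₂ (inj₂ eq) = inj₂ (sym eq)
  ... | inj₂ (inj₁ gt) = contradiction
    (≤-trans (proj₁ (2x·y≤x·x+y·y x y)) (+-mono-≤ ≤-refl y·y≤x·x))
    (<⇒≱ (+-mono-<-≤ gt (inj₁ gt)))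

  sum-replicate : ∀ k t → sumℝ (replicate k t) ≡ t * sumℝ (replicate k 1#)
  sum-replicate zero    t = sym (zeroʳ t)
  sum-replicate (suc k) t =
    trans (cong₂ _+_ (sym (*-identityʳ t)) (sum-replicate k t)) (sym (distribˡ t 1# _))

  0≤sum-1 : ∀ k → 0# ≤ sumℝ (replicate k 1#)
  0≤sum-1 zero    = ≤-refl
  0≤sum-1 (suc k) = subst (_≤ sumℝ (replicate (suc k) 1#)) (+-identityˡ 0#) (+-mono-≤ (inj₁ 0<1) (0≤sum-1 k))

  sum-zeros-except : ∀ {k} (x : Vec ℝ k) i → (∀ j → j ≢ i → lookup x j ≡ 0#) → sumℝ x ≡ lookup x i
  sum-zeros-except (x ∷ xs) zero    zeros =
    trans (cong (_+_ x) (all-zero xs (λ j → zeros (suc j) λ ()))) (+-identityʳ x)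
    where
    all-zero : ∀ {k} (x : Vec ℝ k) → (∀ j → lookup x j ≡ 0#) → sumℝ x ≡ 0#
    all-zero []       _     = refl
    all-zero (x ∷ xs) zeros = trans (cong₂ _+_ (zeros zero) (all-zero xs (zeros ∘ suc))) (+-identityʳ 0#)
  sum-zeros-except (x ∷ xs) (suc i) zeros =
    trans (cong₂ _+_ (zeros zero λ ()) (sum-zeros-except xs i (λ j j≢i → zeros (suc j) λ { refl → j≢i refl })))
          (+-identityˡ _)

  ·-combination-≤ : ∀ {e k} (a : Point e) {b} {w : Vec ℝ k} {q} → All (0# ≤_) w → All (λ x → a · x ≤ b) q →
    a · combination w q ≤ sumℝ w * b
  ·-combination-≤ a {b} {[]} {[]} [] [] = inj₂ (trans (·-zeroʳ a) (sym (zeroˡ b)))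
  ·-combination-≤ a {b} {t ∷ w} {x ∷ q} (0≤t ∷ 0≤w) (x≤ ∷ q≤) =
    subst₂ _≤_ (sym (trans (·-⊕ʳ a (t ⊛ x) _) (cong (_+ a · combination w q) (·-⊛ʳ a t x))))
      (sym (distribʳ b t (sumℝ w)))
      (+-mono-≤ (*-monoʳ-≤ 0≤t x≤) (·-combination-≤ a 0≤w q≤))

  -- The conclusion concerns the weighted value `t * (a · x)` because `t` may be zero; whether `t`
  -- can be cancelled is decided by the callers.
  ·-combination-uncons : ∀ {e k} (a : Point e) {b t x} {w : Vec ℝ k} {q} → 0# ≤ t → All (0# ≤_) w →
    a · x ≤ b → All (λ x → a · x ≤ b) q → a · combination (t ∷ w) (x ∷ q) ≡ sumℝ (t ∷ w) * b →
    t * (a · x) ≡ t * b × a · combination w q ≡ sumℝ w * b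
  ·-combination-uncons a {b} {t} {x} {w} {q} 0≤t 0≤w x≤ q≤ eq =
    +-tight (*-monoʳ-≤ 0≤t x≤) (·-combination-≤ a 0≤w q≤) (begin
      t * (a · x) + a · combination w q   ≡⟨ cong (_+ a · combination w q) (·-⊛ʳ a t x) ⟨
      a · t ⊛ x + a · combination w q     ≡⟨ ·-⊕ʳ a (t ⊛ x) _ ⟨
      a · combination (t ∷ w) (x ∷ q)     ≡⟨ eq ⟩
      (t + sumℝ w) * b                    ≡⟨ distribʳ b t (sumℝ w) ⟩
      t * b + sumℝ w * b                  ∎)
    where open ≡-Reasoning

  ·-combination-tight : ∀ {e k} (a : Point e) {b} {w : Vec ℝ k} {q} → All (0# <_) w → All (λ x → a · x ≤ b) q →
    a · combination w q ≡ sumℝ w * b → All (λ x → a · x ≡ b) q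
  ·-combination-tight a {w = []}    {[]}    []          []        _  = []
  ·-combination-tight a {w = _ ∷ _} {_ ∷ _} (0<t ∷ 0<w) (x≤ ∷ q≤) eq
    with ·-combination-uncons a (inj₁ 0<t) (All.map inj₁ 0<w) x≤ q≤ eq
  ... | head≡ , tail≡ = *-tight 0<t x≤ head≡ ∷ ·-combination-tight a 0<w q≤ tail≡

  ·-combination-≡ : ∀ {e k} (a : Point e) {b} (w : Vec ℝ k) {q} → All (λ x → a · x ≡ b) q →
    a · combination w q ≡ sumℝ w * b
  ·-combination-≡ a {b} []      {[]}    []        = trans (·-zeroʳ a) (sym (zeroˡ b))
  ·-combination-≡ a {b} (t ∷ w) {x ∷ q} (x≡ ∷ q≡) = begin
    a · combination (t ∷ w) (x ∷ q)    ≡⟨ ·-⊕ʳ a (t ⊛ x) _ ⟩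
    a · t ⊛ x + a · combination w q    ≡⟨ cong₂ _+_ (trans (·-⊛ʳ a t x) (cong (t *_) x≡)) (·-combination-≡ a w q≡) ⟩
    t * b + sumℝ w * b                 ≡⟨ distribʳ b t (sumℝ w) ⟨
    (t + sumℝ w) * b                   ∎
    where open ≡-Reasoning

  combination-constant : ∀ {e k} (w : Vec ℝ k) {q} {v : Point e} → All (v ≡_) q → combination w q ≡ sumℝ w ⊛ v
  combination-constant []      {[]}    {v} []           = sym (⊛-zeroˡ v)
  combination-constant (t ∷ w) {x ∷ q} {v} (refl ∷ q≡v) =
    trans (cong (t ⊛ v ⊕_) (combination-constant w q≡v)) (sym (⊛-distribʳ t (sumℝ w) v))

  combination-ones : ∀ {e k} (q : Vec (Point e) k) → combination (replicate k 1#) q ≡ sumᵥ q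
  combination-ones []      = refl
  combination-ones (x ∷ q) = cong₂ _⊕_ (⊛-identityˡ x) (combination-ones q)

  -- conv S is Cone S 1#.
  Cone : ∀ {e} → Pred (Point e) 0ℓ → ℝ → Pred (Point e) 0ℓ
  Cone {e} S s x = ∃[ k ] Σ[ w ∈ Vec ℝ k ] Σ[ q ∈ Vec (Point e) k ]
    All (0# ≤_) w × sumℝ w ≡ s × All S q × combination w q ≡ x

  cone-zero : ∀ {e} {S : Pred (Point e) 0ℓ} → Cone S 0# 𝟎
  cone-zero = 0 , [] , [] , [] , refl , [] , refl

  cone-⊕ : ∀ {e} {S : Pred (Point e) 0ℓ} {s t x y} → Cone S s x → Cone S t y → Cone S (s + t) (x ⊕ y)
  cone-⊕ {t = t} {y = y} (zero , [] , [] , [] , refl , [] , refl) y∈ =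
    subst₂ (Cone _) (sym (+-identityˡ t)) (sym (⊕-identityˡ y)) y∈
  cone-⊕ {t = t} {y = y} (suc k , r ∷ w , z ∷ q , 0≤r ∷ 0≤w , refl , z∈ ∷ q∈ , refl) y∈
    with cone-⊕ (k , w , q , 0≤w , refl , q∈ , refl) y∈
  ... | _ , w′ , q′ , 0≤w′ , sum≡ , q′∈ , comb≡ =
    _ , r ∷ w′ , z ∷ q′ , 0≤r ∷ 0≤w′ , trans (cong (_+_ r) sum≡) (sym (+-assoc r _ t)) , z∈ ∷ q′∈ ,
    trans (cong (r ⊛ z ⊕_) comb≡) (sym (⊕-assoc (r ⊛ z) _ y))

  cone-⊛ : ∀ {e} {S : Pred (Point e) 0ℓ} {s x t} → 0# ≤ t → Cone S s x → Cone S (t * s) (t ⊛ x)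
  cone-⊛ {t = t} 0≤t (zero , [] , [] , [] , refl , [] , refl) =
    subst₂ (Cone _) (sym (zeroʳ t)) (sym (⊛-zeroʳ t)) cone-zero
  cone-⊛ {t = t} 0≤t (suc k , r ∷ w , z ∷ q , 0≤r ∷ 0≤w , refl , z∈ ∷ q∈ , refl)
    with cone-⊛ 0≤t (k , w , q , 0≤w , refl , q∈ , refl)
  ... | _ , w′ , q′ , 0≤w′ , sum≡ , q′∈ , comb≡ =
    _ , t * r ∷ w′ , z ∷ q′ , *-nonneg 0≤t 0≤r ∷ 0≤w′ ,
    trans (cong (_+_ (t * r)) sum≡) (sym (distribˡ t r _)) , z∈ ∷ q′∈ ,
    trans (cong₂ _⊕_ (⊛-assoc t r z) comb≡) (sym (⊛-distribˡ t (r ⊛ z) _))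

  -- The total weight is a parameter because the induction passes through tails of a convex
  -- combination, whose weights need not sum to 1.
  cone-combination : ∀ {e k} {S : Pred (Point e) 0ℓ} {w : Vec ℝ k} {q} → All (0# ≤_) w → All (conv S) q →
    Cone S (sumℝ w) (combination w q)
  cone-combination {w = []}    {[]}    []          []        = cone-zero
  cone-combination {w = t ∷ _} {x ∷ _} (0≤t ∷ 0≤w) (x∈ ∷ q∈) = cone-⊕
    (subst (λ s → Cone _ s (t ⊛ x)) (*-identityʳ t) (cone-⊛ 0≤t x∈))
    (cone-combination 0≤w q∈)

  conv-idempotent : ∀ {e} {S : Pred (Point e) 0ℓ} → conv (conv S) ⊆ conv S
  conv-idempotent (_ , w , q , 0≤w , sum≡ , q∈ , refl) =
    subst (λ s → Cone _ s (combination w q)) sum≡ (cone-combination 0≤w q∈)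

  conv-mono : ∀ {e} {S T : Pred (Point e) 0ℓ} → S ⊆ T → conv S ⊆ conv T
  conv-mono S⊆T (k , w , q , 0≤w , sum≡ , q∈ , comb≡) = k , w , q , 0≤w , sum≡ , All.map S⊆T q∈ , comb≡

  ∈⇒∈conv : ∀ {e} {S : Pred (Point e) 0ℓ} {x} → S x → conv S x
  ∈⇒∈conv {x = x} x∈ = 1 , 1# ∷ [] , x ∷ [] , inj₁ 0<1 ∷ [] , +-identityʳ 1# , x∈ ∷ [] ,
    trans (combination-constant (1# ∷ []) (refl ∷ []))
          (trans (cong (_⊛ x) (+-identityʳ 1#)) (⊛-identityˡ x))

  conv-singleton : ∀ {e} {v x : Point e} → conv (v ≡_) x → v ≡ x
  conv-singleton {v = v} (_ , w , _ , _ , sum≡ , q≡ , refl) =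
    sym (trans (combination-constant w q≡) (trans (cong (_⊛ v) sum≡) (⊛-identityˡ v)))

  conv-≤ : ∀ {e} {S : Pred (Point e) 0ℓ} (a : Point e) {b x} → (∀ {y} → S y → a · y ≤ b) → conv S x → a · x ≤ b
  conv-≤ a {b} S≤b (_ , w , q , 0≤w , sum≡ , q∈ , refl) =
    subst (a · combination w q ≤_) (trans (cong (_* b) sum≡) (*-identityˡ b))
      (·-combination-≤ a 0≤w (All.map S≤b q∈))

  conv-≡ : ∀ {e} {S : Pred (Point e) 0ℓ} (a : Point e) {b x} → (∀ {y} → S y → a · y ≡ b) → conv S x → a · x ≡ b
  conv-≡ a {b} S≡b (_ , w , q , 0≤w , sum≡ , q∈ , refl) =
    trans (·-combination-≡ a w (All.map S≡b q∈)) (trans (cong (_* b) sum≡) (*-identityˡ b))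

  -- This is what makes a face of a hull the hull of the spanning points on it.
  conv-tight : ∀ {e} {S : Pred (Point e) 0ℓ} (a : Point e) {b x} → (∀ {y} → S y → a · y ≤ b) →
    conv S x → a · x ≡ b → conv (λ y → S y × a · y ≡ b) x
  conv-tight {S = S} a {b} S≤b (k , w , q , 0≤w , sum≡ , q∈ , refl) a·x≡b =
    subst (λ s → Cone (λ y → S y × a · y ≡ b) s (combination w q)) sum≡
      (discard 0≤w q∈ (trans a·x≡b (sym (trans (cong (_* b) sum≡) (*-identityˡ b)))))
    where
    -- Only the points of weight 0 can fail to be tight.
    discard : ∀ {k} {w : Vec ℝ k} {q} → All (0# ≤_) w → All S q → a · combination w q ≡ sumℝ w * b →
      Cone (λ y → S y × a · y ≡ b) (sumℝ w) (combination w q)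
    discard {w = []}    {[]}    []          []        _  = cone-zero
    discard {w = t ∷ w} {x ∷ q} (0≤t ∷ 0≤w) (x∈ ∷ q∈) eq
      with ·-combination-uncons a 0≤t 0≤w (S≤b x∈) (All.map S≤b q∈) eq
    ... | head≡ , tail≡ with 0≤t | discard 0≤w q∈ tail≡
    ...   | inj₂ refl | rest = subst₂ (Cone _) (sym (+-identityˡ _))
              (trans (sym (⊕-identityˡ _)) (cong (_⊕ combination w q) (sym (⊛-zeroˡ x)))) rest
    ...   | inj₁ 0<t | _ , w′ , q′ , 0≤w′ , sum≡ , q′∈ , comb≡ =
              _ , t ∷ w′ , x ∷ q′ , 0≤t ∷ 0≤w′ , cong (_+_ t) sum≡ , (x∈ , *-tight 0<t (S≤b x∈) head≡) ∷ q′∈ ,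
              cong (t ⊛ x ⊕_) comb≡

-- Subsets of a finite index set.

module _ {n} {P : Pred (Fin n) 0ℓ} (P? : Decidable P) where

  select : Subset n
  select = tabulate (does ∘ P?)

  ∈-select⁺ : ∀ {i} → P i → i Subset.∈ select
  ∈-select⁺ {i} Pi = lookup⇒[]= i select (trans (lookup∘tabulate _ i) (dec-true (P? i) Pi))

  ∈-select⁻ : ∀ {i} → i Subset.∈ select → P i
  ∈-select⁻ {i} i∈ with P? i | trans (sym (lookup∘tabulate (does ∘ P?) i)) ([]=⇒lookup i∈)
  ... | yes Pi | _ = Pi

⊆∧≢⇒⊂ : ∀ {n} {F U : Subset n} → F Subset.⊆ U → F ≢ U → F Subset.⊂ U
⊆∧≢⇒⊂ {F = F} {U} F⊆U F≢U with Fin.any? (λ i → i ∈? U ×-dec ¬? (i ∈? F))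
... | yes (i , i∈U , i∉F) = F⊆U , i , i∈U , i∉F
... | no none = contradiction
  (⊆-antisym F⊆U λ {i} i∈U → decidable-stable (i ∈? F) λ i∉F → none (i , i∈U , i∉F)) F≢U

-- Faces as systems of inequalities at the spanning points.

module Faces (𝓡 : Reals) where
  open LinearAlgebra 𝓡
  open FiniteSums 𝓡

  argmax : ∀ {n} (U : Subset n) (f : Fin n → ℝ) → Nonempty U →
    ∃[ i ] i Subset.∈ U × (∀ {j} → j Subset.∈ U → f j ≤ f i)
  argmax (s ∷ U) f (i , i∈) with nonempty? U
  argmax (s ∷ U) f (zero  , Vec.here)      | no empty =
    zero , Vec.here , λ { Vec.here → ≤-refl ; (Vec.there j∈) → contradiction (_ , j∈) empty }
  argmax (s ∷ U) f (suc i , Vec.there i∈) | no empty = contradiction (i , i∈) empty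
  argmax (outside ∷ U) f _ | yes nonempty with argmax U (f ∘ suc) nonempty
  ... | j , j∈ , max = suc j , Vec.there j∈ , λ { (Vec.there k∈) → max k∈ }
  argmax (inside ∷ U) f _ | yes nonempty with argmax U (f ∘ suc) nonempty
  ... | j , j∈ , max with ≤-total (f zero) (f (suc j))
  ...   | inj₁ 0≤j = suc j , Vec.there j∈ , λ { Vec.here → 0≤j ; (Vec.there k∈) → max k∈ }
  ...   | inj₂ j≤0 = zero , Vec.here , λ { Vec.here → ≤-refl ; (Vec.there k∈) → ≤-trans (max k∈) j≤0 }

  -- Each `Q i` holds from some threshold on, so the largest threshold serves every `i`.
  common-bound : ∀ {n} {Q : Fin n → Pred ℝ 0ℓ} → (∀ i → ∃[ N ] ∀ {M} → N ≤ M → Q i M) → ∃[ N ] ∀ i → Q i N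
  common-bound {zero}  _      = 0# , λ ()
  common-bound {suc n} bounds with argmax (⊤ {suc n}) (proj₁ ∘ bounds) (zero , ∈⊤)
  ... | i , _ , max = proj₁ (bounds i) , λ j → proj₂ (bounds j) (max ∈⊤)

  module PolytopeFaces {e m} (p : Vec (Point e) m) (c : Point e) where
    open Polytopes p c
    open IsNonemptyFace using (nonempty; isFace) renaming (⊆-whole to face-⊆)

    body-mono : ∀ {F U} → F Subset.⊆ U → body F ⊆ body U
    body-mono F⊆U = conv-mono (λ (i , i∈F , eq) → i , F⊆U i∈F , eq)

    ∈⇒∈body : ∀ {U i} → i Subset.∈ U → body U (lookup p i)
    ∈⇒∈body i∈U = ∈⇒∈conv (_ , i∈U , refl)

    body-inhabited : ∀ {U x} → body U x → Nonempty U
    body-inhabited (zero  , []    , [] , _ , 0≡1 , _ , _)             = contradiction 0<1 (<-irrefl 0≡1)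
    body-inhabited (suc _ , _ ∷ _ , _  , _ , _   , (i , i∈ , _) ∷ _ , _) = i , i∈

    -- A face described at the spanning points only: no hull occurs in the fields, and `F` may be
    -- empty. This makes adding and perturbing functionals a matter of checking each point;
    -- `exposed⇒face` and `face⇒exposed` translate back and forth.
    record Exposed (U F : Subset m) : Set where
      field
        normal  : Point e
        height  : ℝ
        valid   : ∀ {i} → i Subset.∈ U → normal · lookup p i ≤ height
        ⊆-whole : F Subset.⊆ U
        tight⁻  : ∀ {i} → i Subset.∈ F → normal · lookup p i ≡ height
        tight⁺  : ∀ {i} → i Subset.∈ U → normal · lookup p i ≡ height → i Subset.∈ F

      body-valid : ∀ {x} → body U x → normal · x ≤ height
      body-valid = conv-≤ normal λ { (_ , i∈U , refl) → valid i∈U }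

      body-tight⁻ : ∀ {x} → body F x → normal · x ≡ height
      body-tight⁻ = conv-≡ normal λ { (_ , i∈F , refl) → tight⁻ i∈F }

      body-tight⁺ : ∀ {x} → body U x → normal · x ≡ height → body F x
      body-tight⁺ x∈U x≡ = conv-mono (λ { ((i , i∈U , refl) , i≡) → i , tight⁺ i∈U i≡ , refl })
        (conv-tight normal (λ { (_ , i∈U , refl) → valid i∈U }) x∈U x≡)

      bodyFace : body F FaceOf body U
      bodyFace = normal , height , (λ x → body-valid) ,
        (λ x∈F → body-mono ⊆-whole x∈F , body-tight⁻ x∈F) , (λ (x∈U , x≡) → body-tight⁺ x∈U x≡)

    exposed⇒face : ∀ {U F} → Nonempty F → Exposed U F → IsNonemptyFace U F
    exposed⇒face F≢∅ E = record
      { ⊆-whole = ⊆-whole ; nonempty = F≢∅ ; isFace = bodyFace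
      ; saturated = λ i i∈U pᵢ∈F → tight⁺ i∈U (body-tight⁻ pᵢ∈F) }
      where open Exposed E

    face⇒exposed : ∀ {U F} → IsNonemptyFace U F → Exposed U F
    face⇒exposed record { ⊆-whole = F⊆U ; isFace = (a , b , valid , F⊆ , ⊆F) ; saturated = saturated } = record
      { normal = a ; height = b
      ; valid = λ i∈U → valid _ (∈⇒∈body i∈U)
      ; ⊆-whole = F⊆U
      ; tight⁻ = λ i∈F → proj₂ (F⊆ (∈⇒∈body i∈F))
      ; tight⁺ = λ i∈U i≡ → saturated _ i∈U (⊆F (∈⇒∈body i∈U , i≡)) }

    expose : ∀ U (a : Point e) b → (∀ {i} → i Subset.∈ U → a · lookup p i ≤ b) →
      Exposed U (select (λ i → lem (i Subset.∈ U × a · lookup p i ≡ b)))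
    expose U a b valid = record
      { normal = a ; height = b ; valid = valid
      ; ⊆-whole = proj₁ ∘ ∈-select⁻ tight?
      ; tight⁻ = proj₂ ∘ ∈-select⁻ tight?
      ; tight⁺ = λ i∈U i≡ → ∈-select⁺ tight? (i∈U , i≡) }
      where tight? = λ i → lem (i Subset.∈ U × a · lookup p i ≡ b)

    -- A sum of two valid functionals reaches the sum of the heights exactly where both are tight.
    exposed-∩ : ∀ {U F G} → Exposed U F → Exposed U G → Exposed U (F ∩ G)
    exposed-∩ {U} {F} {G} E E′ = record
      { normal = E.normal ⊕ E′.normal ; height = E.height + E′.height
      ; valid = λ i∈U → subst (_≤ E.height + E′.height) (sym (·-⊕ˡ E.normal E′.normal _))
          (+-mono-≤ (E.valid i∈U) (E′.valid i∈U))
      ; ⊆-whole = E.⊆-whole ∘ p∩q⊆p F G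
      ; tight⁻ = λ i∈ → trans (·-⊕ˡ E.normal E′.normal _)
          (cong₂ _+_ (E.tight⁻ (p∩q⊆p F G i∈)) (E′.tight⁻ (p∩q⊆q F G i∈)))
      ; tight⁺ = λ i∈U i≡ → case +-tight (E.valid i∈U) (E′.valid i∈U) (trans (sym (·-⊕ˡ E.normal E′.normal _)) i≡) of
          λ (tight , tight′) → x∈p∩q⁺ (E.tight⁺ i∈U tight , E′.tight⁺ i∈U tight′) }
      where
      module E = Exposed E
      module E′ = Exposed E′

    -- G is cut out of U by a functional N a + a′, where a cuts out F, a′ cuts out
    -- G, and N is so large that points with a-slack stay below whatever a′ does.
    exposed-trans : ∀ {U F G} → Exposed U F → Exposed F G → Exposed U G
    exposed-trans {U} {F} {G} E E′ = build (common-bound eventually)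
      where
      module E = Exposed E
      module E′ = Exposed E′
      a = E.normal
      b = E.height
      a′ = E′.normal
      b′ = E′.height

      Beats : Fin m → Pred ℝ 0ℓ
      Beats i N = a · lookup p i < b → N * (a · lookup p i) + a′ · lookup p i < N * b + b′

      eventually : ∀ i → ∃[ N ] ∀ {M} → N ≤ M → Beats i M
      eventually i with lem (a · lookup p i < b)
      ... | no ≮  = 0# , λ _ ai<b → contradiction ai<b ≮
      ... | yes ai<b with positive-inverse (0<y-x ai<b)
      ...   | t , 0<t , st≡1 = N , beats
        where
        -- The slack `s`, scaled by M, has to exceed the excess `d` of a′ over b′. As `t` is the
        -- inverse of `s`, the choice of `N` gives `s * N ≡ d + 1#`, and since `s` is positive every
        -- larger M works too.
        s = b + - (a · lookup p i)
        d = (a′ · lookup p i + - b′)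
        N = t * (d + 1#)

        d<Ms : ∀ {M} → N ≤ M → d < M * s
        d<Ms {M} N≤M = case subst₂ _≤_ sN≡ (*-comm s M) (*-monoʳ-≤ (inj₁ (0<y-x ai<b)) N≤M) of λ where
            (inj₁ d+1<Ms) → <-trans d<d+1 d+1<Ms
            (inj₂ d+1≡Ms) → subst (d <_) d+1≡Ms d<d+1
          where
          sN≡ : s * N ≡ d + 1#
          sN≡ = trans (sym (*-assoc s t (d + 1#))) (trans (cong (_* (d + 1#)) st≡1) (*-identityˡ (d + 1#)))
          d<d+1 : d < d + 1#
          d<d+1 = subst (_< d + 1#) (+-identityʳ d) (+-monoʳ-< d 0<1)

        beats : ∀ {M} → N ≤ M → Beats i M
        -- Adding `M * (a · lookup p i) + b′` to both sides of `d < M * s` cancels the subtractions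
        -- in `d` and `s`.
        beats {M} N≤M _ = subst₂ _<_
          (trans (solve 3 (λ d b′ r → d :+ (r :+ b′) := r :+ (d :+ b′)) refl d b′ (M * (a · lookup p i)))
                 (cong (λ r → M * (a · lookup p i) + r) (//-rightDividesˡ b′ (a′ · lookup p i))))
          (trans (solve 4 (λ M s r b′ → M :* s :+ (M :* r :+ b′) := M :* (s :+ r) :+ b′) refl M s (a · lookup p i) b′)
                 (cong (λ r → M * r + b′) (//-rightDividesˡ (a · lookup p i) b)))
          (+-monoˡ-< (M * (a · lookup p i) + b′) (d<Ms N≤M))

      build : ∃[ N ] (∀ i → Beats i N) → Exposed U G
      build (N , beats) = record
        { normal = N ⊛ a ⊕ a′ ; height = N * b + b′
        ; valid = λ i∈U → case E.valid i∈U of λ where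
            (inj₁ ai<b) → inj₁ (subst (_< N * b + b′) (sym (expand _)) (beats _ ai<b))
            (inj₂ ai≡b) → subst (_≤ N * b + b′) (sym (expand _))
              (+-mono-≤ (inj₂ (cong (N *_) ai≡b)) (E′.valid (E.tight⁺ i∈U ai≡b)))
        ; ⊆-whole = E.⊆-whole ∘ E′.⊆-whole
        ; tight⁻ = λ i∈G → trans (expand _) (cong₂ _+_ (cong (N *_) (E.tight⁻ (E′.⊆-whole i∈G))) (E′.tight⁻ i∈G))
        ; tight⁺ = λ i∈U i≡ → case E.valid i∈U of λ where
            (inj₁ ai<b) → contradiction (beats _ ai<b) (<-irrefl (trans (sym (expand _)) i≡))
            (inj₂ ai≡b) → E′.tight⁺ (E.tight⁺ i∈U ai≡b)
              (+-cancelˡ (N * b) _ _ (trans (sym (trans (expand _) (cong (λ r → N * r + _) ai≡b))) i≡)) }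
        where
        expand : ∀ x → (N ⊛ a ⊕ a′) · x ≡ N * (a · x) + a′ · x
        expand x = trans (·-⊕ˡ (N ⊛ a) a′ x) (cong (_+ a′ · x) (·-⊛ˡ N a x))

    face-refl : ∀ {U} → Nonempty U → IsNonemptyFace U U
    face-refl U≢∅ = exposed⇒face U≢∅ record
      { normal = 𝟎 ; height = 0# ; valid = λ _ → inj₂ (zero-· _) ; ⊆-whole = λ i∈ → i∈
      ; tight⁻ = λ _ → zero-· _ ; tight⁺ = λ i∈ _ → i∈ }
      where
      zero-· : ∀ (x : Point e) → 𝟎 · x ≡ 0#
      zero-· x = trans (·-comm 𝟎 x) (·-zeroʳ x)

    face-trans : ∀ {U F G} → IsNonemptyFace U F → IsNonemptyFace F G → IsNonemptyFace U G
    face-trans F≤U G≤F = exposed⇒face (nonempty G≤F) (exposed-trans (face⇒exposed F≤U) (face⇒exposed G≤F))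

    face-restrict : ∀ {U F G} → F Subset.⊆ U → IsNonemptyFace U G → G Subset.⊆ F → IsNonemptyFace F G
    face-restrict F⊆U G≤U G⊆F = exposed⇒face (nonempty G≤U) record
      { normal = normal ; height = height ; valid = valid ∘ F⊆U ; ⊆-whole = G⊆F
      ; tight⁻ = tight⁻ ; tight⁺ = tight⁺ ∘ F⊆U }
      where open Exposed (face⇒exposed G≤U)

    -- Hulls of arbitrary sets of spanning points do not intersect like this. For faces, the sum of
    -- the two functionals is tight at `x`, which puts `x` into the hull of the points tight for
    -- both.
    body-∩ : ∀ {U F G x} → IsNonemptyFace U F → IsNonemptyFace U G → body F x → body G x → body (F ∩ G) x
    body-∩ F≤U G≤U x∈F x∈G = Exposed.body-tight⁺ (exposed-∩ E E′) (body-mono (face-⊆ F≤U) x∈F)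
      (trans (·-⊕ˡ (Exposed.normal E) (Exposed.normal E′) _)
             (cong₂ _+_ (Exposed.body-tight⁻ E x∈F) (Exposed.body-tight⁻ E′ x∈G)))
      where
      E = face⇒exposed F≤U
      E′ = face⇒exposed G≤U

    face-∩ : ∀ {U F G x} → IsNonemptyFace U F → IsNonemptyFace U G → body F x → body G x →
      IsNonemptyFace U (F ∩ G)
    face-∩ F≤U G≤U x∈F x∈G = exposed⇒face (body-inhabited (body-∩ F≤U G≤U x∈F x∈G))
      (exposed-∩ (face⇒exposed F≤U) (face⇒exposed G≤U))

    -- Vertices and apexes.

    FaceOf-cong : ∀ {F G Q : Pred (Point e) 0ℓ} → F ≐ G → F FaceOf Q → G FaceOf Q
    FaceOf-cong (F⊆G , G⊆F) (a , b , valid , F⊆ , ⊆F) = a , b , valid , F⊆ ∘ G⊆F , F⊆G ∘ ⊆F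

    vertex∈ : ∀ {Q : Pred (Point e) 0ℓ} {v} → IsVertex Q v → Q v
    vertex∈ (_ , _ , _ , v⊆ , _) = proj₁ (v⊆ refl)

    -- The functional isolating `v` in `F` selects a set of spanning points whose hull is `｛ v ｝`;
    -- in this encoded form `face-trans` applies to it.
    vertex-face : ∀ {U F v} → IsNonemptyFace U F → IsVertex (body F) v → IsVertex (body U) v
    vertex-face {U} {F} {v} F≤U (a , b , valid , v⊆ , ⊆v) = FaceOf-cong (T⊆v , v⊆T)
      (isFace (face-trans F≤U (exposed⇒face (body-inhabited (v⊆T refl)) E)))
      where
      E = expose F a b (λ i∈F → valid _ (∈⇒∈body i∈F))
      open Exposed E hiding (valid)

      T⊆v : body _ ⊆ ｛ v ｝
      T⊆v x∈T = ⊆v (body-mono ⊆-whole x∈T , body-tight⁻ x∈T)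

      v⊆T : ｛ v ｝ ⊆ body _
      v⊆T x≡v = body-tight⁺ (proj₁ (v⊆ x≡v)) (proj₂ (v⊆ x≡v))

    distinct-face : ∀ {U F} → IsNonemptyFace U F → DistinctOnVertices c (body U) → DistinctOnVertices c (body F)
    distinct-face F≤U distinct u v u∈ v∈ = distinct u v (vertex-face F≤U u∈) (vertex-face F≤U v∈)

    -- On the face where c is minimal, a spanning point of maximal norm is a vertex.
    apex-exists : ∀ {U} → Nonempty U → ∃ (IsApex c (body U))
    apex-exists {U} U≢∅ with argmax U (λ i → neg c · lookup p i) U≢∅
    ... | i , i∈U , max = v , vertex-face T≤U (FaceOf-cong (R⊆v , v⊆R) (Exposed.bodyFace R-exposed)) , minimal
      where
      T-exposed = expose U (neg c) (neg c · lookup p i) max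
      T≤U = exposed⇒face (i , Exposed.tight⁺ T-exposed i∈U refl) T-exposed
      far = argmax _ (λ j → lookup p j · lookup p j) (nonempty T≤U)
      v = lookup p (proj₁ far)
      farthest = proj₂ (proj₂ far)
      -- The isolating functional is `v` itself: on points no longer than `v` its value is at most
      -- `v · v`, with equality only at `v`.
      R-exposed = expose _ v (v · v) (λ {j} j∈T → x·y≤x·x {x = v} {lookup p j} (farthest j∈T))

      R⊆v : body _ ⊆ ｛ v ｝
      R⊆v x∈R = conv-singleton (conv-mono (λ { (k , k∈R , refl) →
        x·y≡x·x⇒x≡y (farthest (Exposed.⊆-whole R-exposed k∈R)) (Exposed.tight⁻ R-exposed k∈R) }) x∈R)

      v⊆R : ｛ v ｝ ⊆ body _
      v⊆R refl = ∈⇒∈body (Exposed.tight⁺ R-exposed (proj₁ (proj₂ far)) refl)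

      minimal : ∀ x → body U x → c · v ≤ c · x
      minimal x x∈U = neg-cancel-≤ (subst₂ _≤_ (neg-· c x)
        (trans (sym (Exposed.body-tight⁻ T-exposed (∈⇒∈body (proj₁ (proj₂ far))))) (neg-· c v))
        (Exposed.body-valid T-exposed x∈U))

    apex-isApex : ∀ {U} → Nonempty U → IsApex c (body U) (apex U)
    apex-isApex {U} U≢∅ with lem (∃ (IsApex c (body U)))
    ... | yes (_ , isApex) = isApex
    ... | no  none         = contradiction (apex-exists U≢∅) none

    apex∈body : ∀ {U} → Nonempty U → body U (apex U)
    apex∈body {U} U≢∅ = vertex∈ {Q = body U} (proj₁ (apex-isApex U≢∅))

    -- Both apexes are vertices of `U`, and each minimises `c` on a body that contains the other.
    -- Their values under `c` therefore agree, and `distinct` identifies them.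
    apex-face : ∀ {U F} → DistinctOnVertices c (body U) → IsNonemptyFace U F → body F (apex U) → apex F ≡ apex U
    apex-face {U} {F} distinct F≤U v∈F = distinct (apex F) (apex U) (vertex-face F≤U (proj₁ F-apex)) (proj₁ U-apex)
      (≤-antisym (proj₂ F-apex _ v∈F) (proj₂ U-apex _ (body-mono (face-⊆ F≤U) (apex∈body (nonempty F≤U)))))
      where
      F-apex = apex-isApex (nonempty F≤U)
      U-apex = apex-isApex (body-inhabited (body-mono (face-⊆ F≤U) v∈F))

    ∈-faces⁺ : ∀ {U F} → IsNonemptyFace U F → F List.∈ faces U
    ∈-faces⁺ {U} {F} = ∈-filter⁺ (λ F → lem (IsNonemptyFace U F)) (∈-subsets F)

    ∈-faces⁻ : ∀ {U F} → F List.∈ faces U → IsNonemptyFace U F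
    ∈-faces⁻ {U} = proj₂ ∘ ∈-filter⁻ (λ F → lem (IsNonemptyFace U F)) {xs = subsets m}

    faces-unique : ∀ U → Unique (faces U)
    faces-unique U = Unique.filter⁺ (λ F → lem (IsNonemptyFace U F)) (subsets-unique m)

    sum-determines-face : ∀ {U F k} {x y : Vec (Point e) k} → IsNonemptyFace U F →
      All (body F) x → All (body U) y → sumᵥ x ≡ sumᵥ y → All (body F) y
    sum-determines-face {k = k} {x} {y} F≤U x∈F y∈U sums≡ =
      All.map (λ (y∈U , y≡) → body-tight⁺ y∈U y≡) (All.zip (y∈U ,
      -- A sum is the combination with all weights 1, of total weight k. Because these weights are
      -- positive, no summand can stay below `height`.
      ·-combination-tight normal ones (All.map body-valid y∈U) (begin
        normal · combination (replicate k 1#) y  ≡⟨ cong (normal ·_) (combination-ones y) ⟩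
        normal · sumᵥ y                          ≡⟨ cong (normal ·_) sums≡ ⟨
        normal · sumᵥ x                          ≡⟨ cong (normal ·_) (combination-ones x) ⟨
        normal · combination (replicate k 1#) x  ≡⟨ ·-combination-≡ normal (replicate k 1#) (All.map body-tight⁻ x∈F) ⟩
        sumℝ (replicate k 1#) * height           ∎)))
      where
      open Exposed (face⇒exposed F≤U)
      open ≡-Reasoning
      ones : All (0# <_) (replicate k 1#)
      ones = All.lookup⁻ (λ i → subst (0# <_) (sym (lookup-replicate i 1#)) 0<1)

-- Chains of faces and the sums of their apexes.

module ChainSums (𝓡 : Reals) {e m} (p : Vec (Geometry.Point 𝓡 e) m) (c : Geometry.Point 𝓡 e) where
  open LinearAlgebra 𝓡
  open Faces 𝓡
  open FiniteSums 𝓡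
  open Polytopes p c
  open PolytopeFaces p c
  open IsNonemptyFace using (nonempty; saturated) renaming (⊆-whole to face-⊆)

  ChainSum : Subset m → ℕ → Pred (Point e) 0ℓ
  ChainSum U k x = Σ[ F ∈ Vec (Subset m) k ] IsFaceChain U F × sumᵥ (Vec.map apex F) ≡ x

  -- A combinatorial form of the condition on `conv` and `∂ U`, equivalent to it for nonempty chains
  -- by `interior⇔conv⊈∂`. For the empty chain the two differ when `U` has no proper face: this
  -- condition is then vacuous, while the empty hull lies in `∂ U`.
  InteriorChain : ∀ {k} → Subset m → Vec (Subset m) k → Set
  InteriorChain U F = ∀ {G} → IsNonemptyFace U G → G ≢ U → ¬ All (body G) (Vec.map apex F)

  InteriorChainSum : Subset m → ℕ → Pred (Point e) 0ℓ
  InteriorChainSum U k x = Σ[ F ∈ Vec (Subset m) k ]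
    IsFaceChain U F × InteriorChain U F × sumᵥ (Vec.map apex F) ≡ x

  apexes∈body : ∀ {U k} {F : Vec (Subset m) k} → All (List._∈ faces U) F → All (body U) (Vec.map apex F)
  apexes∈body F∈ = All.map⁺ (All.map (λ {G} G∈ → let G≤U = ∈-faces⁻ G∈ in
    body-mono (face-⊆ G≤U) (apex∈body (nonempty G≤U))) F∈)

  linked⇒head-⊇ : ∀ {k F} {Fs : Vec (Subset m) k} → Linked (λ F G → body F ⊇ body G) (F ∷ Fs) →
    All (λ G → ∀ x → body G x → body F x) (F ∷ Fs)
  linked⇒head-⊇ [-] = (λ _ x∈ → x∈) ∷ []
  linked⇒head-⊇ {Fs = _ ∷ _} (F⊇G ∷ linked) =
    (λ _ x∈ → x∈) ∷ All.map (λ H⊆G x x∈H → F⊇G (H⊆G x x∈H)) (linked⇒head-⊇ linked)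

  apexes∈head : ∀ {U k F} {Fs : Vec (Subset m) k} → IsFaceChain U (F ∷ Fs) → All (body F) (Vec.map apex (F ∷ Fs))
  apexes∈head (F∈ , linked) = All.map⁺ (All.map (λ (G∈ , G⊆F) → G⊆F _ (apex∈body (nonempty (∈-faces⁻ G∈))))
    (All.zip (F∈ , linked⇒head-⊇ linked)))

  chain-extend : ∀ {U F k} {Gs : Vec (Subset m) k} → IsNonemptyFace U F → IsFaceChain F Gs → IsFaceChain U Gs
  chain-extend F≤U (Gs∈ , linked) = All.map (λ G∈ → ∈-faces⁺ (face-trans F≤U (∈-faces⁻ G∈))) Gs∈ , linked

  module _ {U F} (distinct : DistinctOnVertices c (body U)) (F≤U : IsNonemptyFace U F) where

    private
      face-∩ˡ : ∀ {G} → IsNonemptyFace U G → body F (apex G) → IsNonemptyFace F (F ∩ G)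
      face-∩ˡ {G} G≤U v∈F = face-restrict (face-⊆ F≤U) (face-∩ F≤U G≤U v∈F (apex∈body (nonempty G≤U))) (p∩q⊆p F G)

      -- `F ∩ G` is a face of `G` containing `apex G`, so `apex-face` applies with `G` as the whole.
      apex-∩ : ∀ {G} → IsNonemptyFace U G → body F (apex G) → apex (F ∩ G) ≡ apex G
      apex-∩ {G} G≤U v∈F = apex-face (distinct-face G≤U distinct)
        (face-restrict (face-⊆ G≤U) (face-∩ F≤U G≤U v∈F v∈G) (p∩q⊆q F G)) (body-∩ F≤U G≤U v∈F v∈G)
        where v∈G = apex∈body (nonempty G≤U)

      linked-∩ : ∀ {k} {Gs : Vec (Subset m) k} → All (List._∈ faces U) Gs → Linked (λ F G → body F ⊇ body G) Gs →
        Linked (λ F G → body F ⊇ body G) (Vec.map (F ∩_) Gs)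
      linked-∩ _ [] = []
      linked-∩ _ [-] = [-]
      linked-∩ {Gs = G ∷ H ∷ _} (G∈ ∷ Gs∈) (G⊇H ∷ linked) =
        (λ x∈ → body-∩ F≤U (∈-faces⁻ G∈) (body-mono (p∩q⊆p F H) x∈) (G⊇H (body-mono (p∩q⊆q F H) x∈))) ∷
        linked-∩ Gs∈ linked

      apexes-∩ : ∀ {k} {Gs : Vec (Subset m) k} → All (List._∈ faces U) Gs → All (body F) (Vec.map apex Gs) →
        All (List._∈ faces F) (Vec.map (F ∩_) Gs) × Vec.map apex (Vec.map (F ∩_) Gs) ≡ Vec.map apex Gs
      apexes-∩ {Gs = []}    []         []         = [] , refl
      apexes-∩ {Gs = _ ∷ _} (G∈ ∷ Gs∈) (v∈ ∷ vs∈) = let ∩∈ , eq = apexes-∩ Gs∈ vs∈ in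
        ∈-faces⁺ (face-∩ˡ (∈-faces⁻ G∈) v∈) ∷ ∩∈ , cong₂ _∷_ (apex-∩ (∈-faces⁻ G∈) v∈) eq

    chain-∩ : ∀ {k} {Gs : Vec (Subset m) k} → IsFaceChain U Gs → All (body F) (Vec.map apex Gs) →
      IsFaceChain F (Vec.map (F ∩_) Gs) × Vec.map apex (Vec.map (F ∩_) Gs) ≡ Vec.map apex Gs
    chain-∩ (Gs∈ , linked) vs∈ = (proj₁ (apexes-∩ Gs∈ vs∈) , linked-∩ Gs∈ linked) , proj₂ (apexes-∩ Gs∈ vs∈)

    chainSum-face : ∀ {k} {Gs : Vec (Subset m) k} → IsFaceChain U Gs → All (body F) (Vec.map apex Gs) →
      ChainSum F k (sumᵥ (Vec.map apex Gs))
    chainSum-face {Gs = Gs} chain vs∈ =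
      Vec.map (F ∩_) Gs , proj₁ (chain-∩ chain vs∈) , cong sumᵥ (proj₂ (chain-∩ chain vs∈))

  -- F is the smallest face of U whose k-th dilate contains x.
  chainSum-carrier : ∀ {U k x} → Acc Subset._⊂_ U → Nonempty U → DistinctOnVertices c (body U) → ChainSum U k x →
    ∃[ F ] IsNonemptyFace U F × InteriorChainSum F k x
  chainSum-carrier {U} (acc rs) U≢∅ distinct (Gs , chain , refl) =
    case lem (∃[ F ] IsNonemptyFace U F × F ≢ U × All (body F) (Vec.map apex Gs)) of λ where
      (no none) → U , face-refl U≢∅ , Gs , chain , (λ {_} F≤U F≢U vs∈ → none (_ , F≤U , F≢U , vs∈)) , refl
      (yes (F , F≤U , F≢U , vs∈)) →
        let G , G≤F , G-sum = chainSum-carrier (rs (⊆∧≢⇒⊂ (face-⊆ F≤U) F≢U)) (nonempty F≤U)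
                                (distinct-face F≤U distinct) (chainSum-face distinct F≤U chain vs∈)
        in G , face-trans F≤U G≤F , G-sum

  interiorChainSum⇒chainSum : ∀ {U F k x} → IsNonemptyFace U F → InteriorChainSum F k x → ChainSum U k x
  interiorChainSum⇒chainSum F≤U (Gs , chain , _ , sum≡) = Gs , chain-extend F≤U chain , sum≡

  apexes∈carrier : ∀ {U F k} {y : Vec (Point e) k} → IsNonemptyFace U F → InteriorChainSum F k (sumᵥ y) →
    All (body U) y → All (body F) y
  apexes∈carrier F≤U (Gs , (Gs∈ , _) , _ , sum≡) y∈U = sum-determines-face F≤U (apexes∈body Gs∈) y∈U sum≡

  -- The apexes summing to `x` in `F` also lie in `G`, because their sum does not distinguish them
  -- from the tuple in `G`. Hence they lie in the face `F ∩ G` of `F`, and interiority excludes a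
  -- proper one. Length `suc k` supplies a point of the intersection; with empty chains every vertex
  -- would carry the sum `𝟎`.
  carrier-⊆ : ∀ {U F G k x} → IsNonemptyFace U F → IsNonemptyFace U G →
    InteriorChainSum F (suc k) x → InteriorChainSum G (suc k) x → F Subset.⊆ G
  carrier-⊆ {F = F} {G} F≤U G≤U (Hs@(_ ∷ _) , (Hs∈ , _) , interior , refl) G-sum i∈F =
    case lem (F ∩ G ≡ F) of λ where
      (yes F∩G≡F) → p∩q⊆q F G (subst (_ Subset.∈_) (sym F∩G≡F) i∈F)
      (no  F∩G≢F) → contradiction vs∈F∩G (interior (face-restrict (face-⊆ F≤U)
        (face-∩ F≤U G≤U (All.head vs∈F) (All.head vs∈G)) (p∩q⊆p F G)) F∩G≢F)
    where
    vs∈F = apexes∈body Hs∈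
    vs∈G = apexes∈carrier G≤U G-sum (All.map (body-mono (face-⊆ F≤U)) vs∈F)
    vs∈F∩G = All.map (λ (x∈F , x∈G) → body-∩ F≤U G≤U x∈F x∈G) (All.zip (vs∈F , vs∈G))

  carrier-unique : ∀ {U F G k x} → F List.∈ faces U → G List.∈ faces U →
    InteriorChainSum F (suc k) x → InteriorChainSum G (suc k) x → F ≡ G
  carrier-unique F∈ G∈ F-sum G-sum = ⊆-antisym
    (carrier-⊆ (∈-faces⁻ F∈) (∈-faces⁻ G∈) F-sum G-sum) (carrier-⊆ (∈-faces⁻ G∈) (∈-faces⁻ F∈) G-sum F-sum)

  chain-cons : ∀ {U k} {Fs : Vec (Subset m) k} → Nonempty U → IsFaceChain U Fs → IsFaceChain U (U ∷ Fs)
  chain-cons U≢∅ ([] , []) = ∈-faces⁺ (face-refl U≢∅) ∷ [] , [-]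
  chain-cons U≢∅ (F∈ ∷ Fs∈ , linked) =
    ∈-faces⁺ (face-refl U≢∅) ∷ F∈ ∷ Fs∈ , body-mono (face-⊆ (∈-faces⁻ F∈)) ∷ linked

  replicate-chain : ∀ {U} → Nonempty U → ∀ k → IsFaceChain U (replicate k U)
  replicate-chain U≢∅ zero    = [] , []
  replicate-chain U≢∅ (suc k) = chain-cons U≢∅ (replicate-chain U≢∅ k)

  -- The two recursions as decompositions of sets of sums.

  ProperInterior : Subset m → ℕ → Pred (Point e) 0ℓ
  ProperInterior U k x = ∃[ F ] F List.∈ faces U × F Subset.⊂ U × InteriorChainSum F k x

  avoidingApex : Subset m → List (Subset m)
  avoidingApex U = List.filter (λ F → lem (apex U ∉ body F)) (faces U)

  ∈-avoidingApex⁺ : ∀ {U F} → F List.∈ faces U → apex U ∉ body F → F List.∈ avoidingApex U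
  ∈-avoidingApex⁺ {U} = ∈-filter⁺ (λ F → lem (apex U ∉ body F))

  ∈-avoidingApex⁻ : ∀ {U F} → F List.∈ avoidingApex U → F List.∈ faces U × apex U ∉ body F
  ∈-avoidingApex⁻ {U} = ∈-filter⁻ (λ F → lem (apex U ∉ body F)) {xs = faces U}

  ApexTranslate AvoidingInterior : Subset m → ℕ → Pred (Point e) 0ℓ
  ApexTranslate U k x = ∃[ y ] ChainSum U k y × apex U ⊕ y ≡ x
  AvoidingInterior U k x = ∃[ F ] F List.∈ avoidingApex U × F Subset.⊂ U × InteriorChainSum F k x

  chainSum-suc : ∀ {U k} → Nonempty U → DistinctOnVertices c (body U) →
    ApexTranslate U k ∪ AvoidingInterior U (suc k) ≐ ChainSum U (suc k)
  chainSum-suc {U} {k} U≢∅ distinct = forth , back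
    where
    forth : ApexTranslate U k ∪ AvoidingInterior U (suc k) ⊆ ChainSum U (suc k)
    forth (inj₁ (_ , (Gs , chain , refl) , refl)) = U ∷ Gs , chain-cons U≢∅ chain , refl
    forth (inj₂ (F , F∈ , _ , F-sum)) = interiorChainSum⇒chainSum (∈-faces⁻ (proj₁ (∈-avoidingApex⁻ F∈))) F-sum

    outside-apex : ∀ {F G x} → IsNonemptyFace U F → apex U ∉ body F → IsNonemptyFace F G →
      InteriorChainSum G (suc k) x → AvoidingInterior U (suc k) x
    outside-apex {F} {G} F≤U v∉F G≤F G-sum =
      G , ∈-avoidingApex⁺ (∈-faces⁺ G≤U) v∉G , ⊆∧≢⇒⊂ (face-⊆ G≤U) G≢U , G-sum
      where
      G≤U = face-trans F≤U G≤F

      v∉G : apex U ∉ body G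
      v∉G v∈G = v∉F (body-mono (face-⊆ G≤F) v∈G)

      G≢U : G ≢ U
      G≢U G≡U = v∉G (subst (λ H → body H (apex U)) (sym G≡U) (apex∈body U≢∅))

    back : ChainSum U (suc k) ⊆ ApexTranslate U k ∪ AvoidingInterior U (suc k)
    back (F ∷ Gs , chain@(F∈ ∷ Gs∈ , linked) , refl) = let F≤U = ∈-faces⁻ F∈ in
      case lem (body F (apex U)) of λ where
        (yes v∈F) → inj₁ (sumᵥ (Vec.map apex Gs) , (Gs , (Gs∈ , Linked.tail linked) , refl) ,
          cong (_⊕ sumᵥ (Vec.map apex Gs)) (sym (apex-face distinct F≤U v∈F)))
        -- All apexes of the chain lie in its first face `F`. The carrier is sought inside `F`, not
        -- just inside `U`, so that it inherits the absence of `apex U`.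
        (no v∉F) →
          let G , G≤F , G-sum = chainSum-carrier (⊂-wellFounded F) (nonempty F≤U) (distinct-face F≤U distinct)
                                  (chainSum-face distinct F≤U chain (apexes∈head chain))
          in inj₂ (outside-apex F≤U v∉F G≤F G-sum)

  -- If `F` carries a sum that has `apex U` as a summand, every summand lies in `F`, in particular
  -- `apex U`.
  translate-avoiding-disjoint : ∀ {U k} → Nonempty U → ∀ {x} → ApexTranslate U k x → ¬ AvoidingInterior U (suc k) x
  translate-avoiding-disjoint U≢∅ (_ , (Gs , (Gs∈ , _) , refl) , refl) (F , F∈ , _ , F-sum) =
    proj₂ (∈-avoidingApex⁻ F∈) (All.head (apexes∈carrier {y = _ ∷ Vec.map apex Gs}
      (∈-faces⁻ (proj₁ (∈-avoidingApex⁻ F∈))) F-sum (apex∈body U≢∅ ∷ apexes∈body Gs∈)))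

  -- The carrier of a sum is either `U` or a proper face, and by `carrier-⊆` it cannot be both.
  interiorChainSum-complement : ∀ {U k} → Nonempty U → DistinctOnVertices c (body U) →
    ChainSum U (suc k) Unary.∩ ∁ (ProperInterior U (suc k)) ≐ InteriorChainSum U (suc k)
  interiorChainSum-complement {U} {k} U≢∅ distinct = forth , back
    where
    forth : ChainSum U (suc k) Unary.∩ ∁ (ProperInterior U (suc k)) ⊆ InteriorChainSum U (suc k)
    forth {x} (x∈ , x∉) =
      let F , F≤U , F-sum = chainSum-carrier (⊂-wellFounded U) U≢∅ distinct x∈
      in case lem (F ≡ U) of λ where
        (yes F≡U) → subst (λ G → InteriorChainSum G (suc k) x) F≡U F-sum
        (no  F≢U) → contradiction (F , ∈-faces⁺ F≤U , ⊆∧≢⇒⊂ (face-⊆ F≤U) F≢U , F-sum) x∉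

    back : InteriorChainSum U (suc k) ⊆ ChainSum U (suc k) Unary.∩ ∁ (ProperInterior U (suc k))
    back x∈ = interiorChainSum⇒chainSum (face-refl U≢∅) x∈ , λ (F , F∈ , (_ , i , i∈U , i∉F) , F-sum) →
      i∉F (carrier-⊆ (face-refl U≢∅) (∈-faces⁻ F∈) x∈ F-sum i∈U)

  -- Interiority in terms of the boundary.

  conv⊆body : ∀ {U k} {x : Vec (Point e) k} → All (body U) x → conv (Vec._∈ x) ⊆ body U
  conv⊆body x∈U y∈ = conv-idempotent (conv-mono (All.lookup x∈U) y∈)

  barycenter : ∀ {k} (x : Vec (Point e) (suc k)) →
    ∃[ w ] All (0# <_) w × sumℝ w ≡ 1# × conv (Vec._∈ x) (combination w x)
  barycenter {k} x with positive-inverse 0<1+k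
    where
    0<1+k : 0# < sumℝ (replicate (suc k) 1#)
    0<1+k = subst (_< sumℝ (replicate (suc k) 1#)) (+-identityˡ 0#) (+-mono-<-≤ 0<1 (0≤sum-1 k))
  ... | t , 0<t , st≡1 = w , 0<w , sum≡1 ,
    suc k , w , x , All.map inj₁ 0<w , sum≡1 , All.lookup⁻ (λ i → ∈-lookup i x) , refl
    where
    w = replicate (suc k) t
    0<w = All.lookup⁻ (λ i → subst (0# <_) (sym (lookup-replicate i t)) 0<t)
    sum≡1 = trans (sum-replicate (suc k) t) (trans (*-comm t _) st≡1)

  -- The hull could a priori lie in the boundary while meeting several proper faces. But its
  -- barycenter has positive weight at every apex, so a face containing the barycenter contains all
  -- apexes.
  interior⇔conv⊈∂ : ∀ {U k} {Fs : Vec (Subset m) (suc k)} → All (List._∈ faces U) Fs →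
    InteriorChain U Fs ⇔ (conv (Vec._∈ Vec.map apex Fs) ⊈ ∂ U)
  interior⇔conv⊈∂ {U} {Fs = Fs} Fs∈ = mk⇔ forth back
    where
    vs = Vec.map apex Fs

    forth : InteriorChain U Fs → ¬ conv (Vec._∈ vs) ⊆ ∂ U
    forth interior conv⊆∂ =
      let w , 0<w , sum≡1 , y∈conv = barycenter vs
          G , G∈ , G≢U , y∈G = conv⊆∂ y∈conv
          open Exposed (face⇒exposed (∈-faces⁻ G∈))
      in interior (∈-faces⁻ G∈) G≢U
        (All.map (λ (v∈U , v≡) → body-tight⁺ v∈U v≡) (All.zip (apexes∈body Fs∈ ,
          ·-combination-tight normal 0<w (All.map body-valid (apexes∈body Fs∈))
            (trans (body-tight⁻ y∈G) (sym (trans (cong (_* height) sum≡1) (*-identityˡ height)))))))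

    back : ¬ conv (Vec._∈ vs) ⊆ ∂ U → InteriorChain U Fs
    back ⊈∂ {G} G≤U G≢U vs∈G = ⊈∂ (λ y∈ → G , ∈-faces⁺ G≤U , G≢U , conv⊆body vs∈G y∈)

  -- Dimension zero.

  -- The affine functional `a · x + - b` vanishes at `lookup p j` and takes the value `|pᵢ - pⱼ|²`
  -- at `lookup p i`. Applied to an affine relation supported on the pair, it leaves only the term
  -- of `i`; the weight at `j` then vanishes because the weights sum to zero.
  affinelyIndependent-pair : ∀ {i j} → lookup p i ≢ lookup p j → AffinelyIndependent (⁅ i ⁆ Subset.∪ ⁅ j ⁆)
  affinelyIndependent-pair {i} {j} pᵢ≢pⱼ w supported sum≡0 comb≡0 = begin
    w                                     ≡⟨ tabulate∘lookup w ⟨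
    tabulate (lookup w)                   ≡⟨ tabulate-cong w≡0 ⟩
    tabulate (lookup (replicate m 0#))    ≡⟨ tabulate∘lookup (replicate m 0#) ⟩
    replicate m 0#                        ∎
    where
    open ≡-Reasoning
    a = lookup p i ⊕ neg (lookup p j)
    b = a · lookup p j

    zero-elsewhere : ∀ k → k ≢ i → k ≢ j → lookup w k ≡ 0#
    zero-elsewhere k k≢i k≢j = supported k λ k∈ →
      [ k≢i ∘ x∈⁅y⁆⇒x≡y i , k≢j ∘ x∈⁅y⁆⇒x≡y j ]′ (x∈p∪q⁻ ⁅ i ⁆ ⁅ j ⁆ k∈)

    deviation : ℝ → Point e → ℝ
    deviation t x = t * (a · x + - b)

    sum-deviation : ∀ {k} (w : Vec ℝ k) q →
      sumℝ (zipWith deviation w q) + sumℝ w * b ≡ a · combination w q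
    sum-deviation []      []      = trans (+-identityˡ _) (trans (zeroˡ b) (sym (·-zeroʳ a)))
    sum-deviation (t ∷ w) (x ∷ q) = begin
      deviation t x + S + (t + sumℝ w) * b
        ≡⟨ solve 5 (λ t d b S s → t :* d :+ S :+ (t :+ s) :* b := t :* (d :+ b) :+ (S :+ s :* b)) refl
             t (a · x + - b) b S (sumℝ w) ⟩
      t * (a · x + - b + b) + (S + sumℝ w * b)
        ≡⟨ cong₂ _+_ (cong (t *_) (//-rightDividesˡ b (a · x))) (sum-deviation w q) ⟩
      t * (a · x) + a · combination w q
        ≡⟨ cong (_+ a · combination w q) (·-⊛ʳ a t x) ⟨
      a · t ⊛ x + a · combination w q
        ≡⟨ ·-⊕ʳ a (t ⊛ x) _ ⟨
      a · combination (t ∷ w) (x ∷ q) ∎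
      where S = sumℝ (zipWith deviation w q)

    sum-deviation≡0 : sumℝ (zipWith deviation w p) ≡ 0#
    sum-deviation≡0 = begin
      S                 ≡⟨ +-identityʳ S ⟨
      S + 0#            ≡⟨ cong (_+_ S) (trans (cong (_* b) sum≡0) (zeroˡ b)) ⟨
      S + sumℝ w * b    ≡⟨ sum-deviation w p ⟩
      a · combination w p ≡⟨ cong (a ·_) comb≡0 ⟩
      a · 𝟎             ≡⟨ ·-zeroʳ a ⟩
      0#                ∎
      where S = sumℝ (zipWith deviation w p)

    a·pᵢ≢b : a · lookup p i + - b ≢ 0#
    -- Cleared of subtractions, `a · x ≡ b` reads `x · y + x · y ≡ x · x + y · y`, the equality case
    -- that gives `x ≡ y`.
    a·pᵢ≢b ≡0 = pᵢ≢pⱼ (proj₂ (2x·y≤x·x+y·y x y) (begin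
      x · y + x · y                      ≡⟨ cong (_+_ (x · y)) (·-comm x y) ⟩
      x · y + y · x                      ≡⟨ cong (_+ y · x) (//-rightDividesˡ (y · y) (x · y)) ⟨
      x · y + - (y · y) + y · y + y · x  ≡⟨ cong (λ r → r + y · y + y · x)
                                              (trans (a·z x) (trans (x∙y⁻¹≈ε⇒x≈y _ _ ≡0) (sym (a·z y)))) ⟨
      x · x + - (y · x) + y · y + y · x  ≡⟨ solve 4 (λ r s t u → r :+ s :+ t :+ u := r :+ s :+ u :+ t) refl
                                              (x · x) (- (y · x)) (y · y) (y · x) ⟩
      x · x + - (y · x) + y · x + y · y  ≡⟨ cong (_+ y · y) (//-rightDividesˡ (y · x) (x · x)) ⟩
      x · x + y · y                      ∎))
      where
      x = lookup p i
      y = lookup p j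
      a·z : ∀ z → x · z + - (y · z) ≡ a · z
      a·z z = sym (trans (·-⊕ˡ x (neg y) z) (cong (_+_ (x · z)) (neg-· y z)))

    wᵢ≡0 : lookup w i ≡ 0#
    wᵢ≡0 = x*y≡0⇒x≡0 a·pᵢ≢b (trans (sym (lookup-zipWith deviation i w p))
      (trans (sym (sum-zeros-except (zipWith deviation w p) i vanish)) sum-deviation≡0))
      where
      vanish : ∀ k → k ≢ i → lookup (zipWith deviation w p) k ≡ 0#
      vanish k k≢i = trans (lookup-zipWith deviation k w p) (case k Fin.≟ j of λ where
        (yes refl) → trans (cong (lookup w k *_) (-‿inverseʳ b)) (zeroʳ _)
        (no k≢j)   → trans (cong (_* (a · lookup p k + - b)) (zero-elsewhere k k≢i k≢j)) (zeroˡ _))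

    wⱼ≡0 : lookup w j ≡ 0#
    wⱼ≡0 = trans (sym (sum-zeros-except w j λ k k≢j → case k Fin.≟ i of λ where
      (yes refl) → wᵢ≡0
      (no k≢i)   → zero-elsewhere k k≢i k≢j)) sum≡0

    w≡0 : ∀ k → lookup w k ≡ lookup (replicate m 0#) k
    w≡0 k = trans (case (k Fin.≟ i) , (k Fin.≟ j) of λ where
      (yes refl , _)       → wᵢ≡0
      (no _ , yes refl)    → wⱼ≡0
      (no k≢i , no k≢j)    → zero-elsewhere k k≢i k≢j) (sym (lookup-replicate k 0#))

  -- Two distinct points would form an affinely independent pair, and a two-element set already
  -- makes the maximum defining `dim U` at least 1.
  dim≡0⇒constant : ∀ {U i j} → dim U ≡ 0 → i Subset.∈ U → j Subset.∈ U → lookup p i ≡ lookup p j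
  dim≡0⇒constant {U} {i} {j} dim≡0 i∈U j∈U with lem (lookup p i ≡ lookup p j)
  ... | yes pᵢ≡pⱼ = pᵢ≡pⱼ
  ... | no  pᵢ≢pⱼ = contradiction (subst (1 ℕ.≤_) dim≡0 (ℕ.≤-trans (ℕ.∸-monoˡ-≤ 1 2≤∣T∣) ∣T∣-1≤dim)) λ ()
    where
    T = ⁅ i ⁆ Subset.∪ ⁅ j ⁆
    i∈T = x∈p∪q⁺ {p = ⁅ i ⁆} {⁅ j ⁆} (inj₁ (x∈⁅x⁆ i))
    j∈T = x∈p∪q⁺ {p = ⁅ i ⁆} {⁅ j ⁆} (inj₂ (x∈⁅x⁆ j))

    T⊆U : T Subset.⊆ U
    T⊆U k∈T with x∈p∪q⁻ ⁅ i ⁆ ⁅ j ⁆ k∈T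
    ... | inj₁ k∈ = subst (Subset._∈ U) (sym (x∈⁅y⁆⇒x≡y i k∈)) i∈U
    ... | inj₂ k∈ = subst (Subset._∈ U) (sym (x∈⁅y⁆⇒x≡y j k∈)) j∈U

    2≤∣T∣ : 2 ℕ.≤ ∣ T ∣
    2≤∣T∣ = ℕ.≤-trans
      (s≤s (ℕ.≤-trans (s≤s z≤n) (x∈p⇒∣p-x∣<∣p∣ (x∈p∧x≢y⇒x∈p-y j∈T λ { refl → pᵢ≢pⱼ refl }))))
      (x∈p⇒∣p-x∣<∣p∣ i∈T)

    independent? = λ T → lem (T Subset.⊆ U × AffinelyIndependent T)

    ∣T∣-1≤dim : ∣ T ∣ ℕ.∸ 1 ℕ.≤ dim U
    ∣T∣-1≤dim = ListAll.lookup (xs≤max 0 (List.map (λ T → ∣ T ∣ ℕ.∸ 1) (List.filter independent? (subsets m))))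
      (∈-map⁺ (λ T → ∣ T ∣ ℕ.∸ 1) (∈-filter⁺ independent? (∈-subsets T) (T⊆U , affinelyIndependent-pair pᵢ≢pⱼ)))

  module _ {U} (U≢∅ : Nonempty U) (dim≡0 : dim U ≡ 0) where

    private
      v = lookup p (proj₁ U≢∅)

      body⊆v : body U ⊆ ｛ v ｝
      body⊆v x∈ = conv-singleton (conv-mono (λ { (_ , j∈U , refl) → dim≡0⇒constant dim≡0 (proj₂ U≢∅) j∈U }) x∈)

      constant-sum : ∀ {k} {x : Vec (Point e) k} → All (body U) x → sumᵥ (replicate k v) ≡ sumᵥ x
      constant-sum []        = refl
      constant-sum (x∈ ∷ xs∈) = cong₂ _⊕_ (body⊆v x∈) (constant-sum xs∈)

      -- A nonempty face contains one spanning point, all the others coincide with it as points, and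
      -- saturation puts their indices into the face as well.
      faces-trivial : ∀ {G} → IsNonemptyFace U G → G ≡ U
      faces-trivial {G} G≤U = ⊆-antisym (face-⊆ G≤U) λ i∈U → let j , j∈G = nonempty G≤U in
        saturated G≤U _ i∈U (subst (body G) (dim≡0⇒constant dim≡0 (face-⊆ G≤U j∈G) i∈U) (∈⇒∈body j∈G))

    ∣interiorChainSum∣-dim0 : ∀ k → + 1 ≡∣ InteriorChainSum U k ∣
    ∣interiorChainSum∣-dim0 k = ∣∣-cong
      ( (λ { refl → replicate k U , chain , (λ {_} G≤U G≢U _ → G≢U (faces-trivial G≤U)) ,
                   sym (constant-sum (apexes∈body (proj₁ chain))) })
      , (λ { (_ , (Fs∈ , _) , _ , refl) → constant-sum (apexes∈body Fs∈) }) ) (∣｛｝∣ (sumᵥ (replicate k v)))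
      where chain = replicate-chain U≢∅ k

    ∣chainSum∣-dim0 : ∀ k → + 1 ≡∣ ChainSum U k ∣
    ∣chainSum∣-dim0 k = ∣∣-cong
      ( interiorChainSum⇒chainSum (face-refl U≢∅)
      , (λ (Fs , chain , sum≡) → Fs , chain , (λ {_} G≤U G≢U _ → G≢U (faces-trivial G≤U)) , sum≡) )
      (∣interiorChainSum∣-dim0 k)

  -- The polytope numbers count the sums.

  mutual
    -- The dimension is passed as `d` with an equation so that matching on `d` unfolds `number`. The
    -- argument exceeds the chain length by one: at 1 only the empty sum `𝟎` is counted.
    number-counts : ∀ d U (a : Acc Subset._⊂_ U) → dim U ≡ d → Nonempty U → DistinctOnVertices c (body U) →
      ∀ k → number d U a (suc k) ≡∣ ChainSum U k ∣
    number-counts zero    U a dim≡ U≢∅ distinct k = ∣chainSum∣-dim0 U≢∅ dim≡ k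
    number-counts (suc d) U a dim≡ U≢∅ distinct zero = ∣∣-cong
      ((λ { refl → [] , ([] , []) , refl }) , (λ { ([] , _ , refl) → refl })) (∣｛｝∣ 𝟎)
    number-counts (suc d) U a@(acc rs) dim≡ U≢∅ distinct (suc k) = ∣∣-cong (chainSum-suc U≢∅ distinct)
      (∣∪∣ (translate-avoiding-disjoint U≢∅)
        (∣map∣ (apex U ⊕_) (⊕-cancelˡ (apex U)) (number-counts (suc d) U a dim≡ U≢∅ distinct k))
        (∣sumBelow∣ p c U (avoidingApex U) _ (λ F → InteriorChainSum F (suc k))
          (Unique.filter⁺ (λ F → lem (apex U ∉ body F)) (faces-unique U))
          (λ F∈ G∈ → carrier-unique (proj₁ (∈-avoidingApex⁻ F∈)) (proj₁ (∈-avoidingApex⁻ G∈)))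
          (λ {F} F⊂U F∈ → let F≤U = ∈-faces⁻ (proj₁ (∈-avoidingApex⁻ F∈)) in
            interior-counts (dim F) F (rs F⊂U) refl (nonempty F≤U) (distinct-face F≤U distinct) k)))

    -- The first argument covered is 2, that is, chains of length 1, since carriers of sums are
    -- unique only from there on.
    interior-counts : ∀ d U (a : Acc Subset._⊂_ U) → dim U ≡ d → Nonempty U → DistinctOnVertices c (body U) →
      ∀ k → interior d U a (suc (suc k)) ≡∣ InteriorChainSum U (suc k) ∣
    interior-counts zero    U a dim≡ U≢∅ distinct k = ∣interiorChainSum∣-dim0 U≢∅ dim≡ (suc k)
    interior-counts (suc d) U a@(acc rs) dim≡ U≢∅ distinct k = ∣∣-cong (interiorChainSum-complement U≢∅ distinct)
      (∣∖∣ (λ x → lem (ProperInterior U (suc k) x))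
        (λ (F , F∈ , _ , F-sum) → interiorChainSum⇒chainSum (∈-faces⁻ F∈) F-sum)
        (number-counts (suc d) U a dim≡ U≢∅ distinct (suc k))
        (∣sumBelow∣ p c U (faces U) _ (λ F → InteriorChainSum F (suc k)) (faces-unique U) carrier-unique
          (λ {F} F⊂U F∈ → let F≤U = ∈-faces⁻ F∈ in
            interior-counts (dim F) F (rs F⊂U) refl (nonempty F≤U) (distinct-face F≤U distinct) k)))

  number-zero : ∀ d U a → number d U a 0 ≡ + 0
  number-zero zero    _ _ = refl
  number-zero (suc d) _ _ = refl

  interior-zero : ∀ d U a → interior d U a 0 ≡ + 0
  interior-zero zero    _ _ = refl
  interior-zero (suc d) _ _ = refl

  number-one : ∀ d U a → number d U a 1 ≡ + 1
  number-one zero    _ _ = refl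
  number-one (suc d) _ _ = refl

  interior-one-dim0 : ∀ {d} U a → d ≡ 0 → interior d U a 1 ≡ + 1
  interior-one-dim0 _ _ refl = refl

  interior-one : ∀ {d} U a → 1 ℕ.≤ d → interior d U a 1 ≡ + 0
  interior-one _ _ (s≤s _) = refl

open import Data.Nat using (_≤_; _∸_)
open import Data.Vec using (map)
open import Data.Vec.Membership.Propositional using (_∈_)

theorem3p4 : (𝓡 : Reals) → let open Geometry 𝓡 in
    ∀ {e m} (p : Vec (Point e) (suc m)) (c : Point e) → let open Polytopes p c in let P = ⊤ {suc m} in
    DistinctOnVertices c (body P) →
    ∀ (d : ℕ) → dim P ≡ d →
    (polytopeNumber P 0 ≡ + 0 × interiorPolytopeNumber P 0 ≡ + 0 × + 0 ≡∣ ∅ {A = Point e} ∣) ×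
    (polytopeNumber P 1 ≡ + 1 × + 1 ≡∣ ｛ 𝟎 {e} ｝ ∣) ×
    (d ≡ 0 → interiorPolytopeNumber P 1 ≡ + 1 × + 1 ≡∣ ｛ 𝟎 {e} ｝ ∣) ×
    (1 ≤ d → interiorPolytopeNumber P 1 ≡ + 0 × + 0 ≡∣ ∅ {A = Point e} ∣) ×
    (∀ n → 2 ≤ n →
    (polytopeNumber P n
    ≡∣ (λ x → Σ[ F ∈ Vec (Subset (suc m)) (n ∸ 1) ]
    IsFaceChain P F × sumᵥ (map apex F) ≡ x) ∣) ×
    (interiorPolytopeNumber P n
    ≡∣ (λ x → Σ[ F ∈ Vec (Subset (suc m)) (n ∸ 1) ]
    IsFaceChain P F × conv (_∈ map apex F) ⊈ ∂ P × sumᵥ (map apex F) ≡ x) ∣))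
theorem3p4 𝓡 {m = m} p c distinct d refl =
  (number-zero (dim P) P (⊂-wellFounded P) , interior-zero (dim P) P (⊂-wellFounded P) , ∣∅∣) ,
  (number-one (dim P) P (⊂-wellFounded P) , ∣｛｝∣ 𝟎) ,
  (λ d≡0 → interior-one-dim0 P _ d≡0 , ∣｛｝∣ 𝟎) ,
  (λ 1≤d → interior-one P _ 1≤d , ∣∅∣) ,
  -- Here the chains have length `suc k`, so they are nonempty, as the translation of interiority
  -- into `conv` and `∂` requires.
  λ { (suc (suc k)) (s≤s (s≤s _)) →
    number-counts _ P _ refl P≢∅ distinct (suc k) ,
    ∣∣-cong
      ( (λ (F , chain , interior , sum≡) →
          F , chain , to (interior⇔conv⊈∂ (proj₁ chain)) (λ {G} → interior {G}) , sum≡)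
      , (λ (F , chain , ⊈∂ , sum≡) →
          F , chain , (λ {G} → from (interior⇔conv⊈∂ (proj₁ chain)) ⊈∂ {G}) , sum≡))
      (interior-counts _ P _ refl P≢∅ distinct k) }
  where
  open Geometry 𝓡
  open Polytopes p c
  open ChainSums 𝓡 p c
  P = ⊤ {suc m}
  P≢∅ : Nonempty P
  P≢∅ = zero , ∈⊤
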